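{- Let $g$ be a positive integer and, for an integer $q$, let $\#\mathcal F(g,q)$ denote the number of gapsets of genus $g$ and depth $q$. Then: (1) $\#\mathcal F(g,1)=1$; (2) $\#\mathcal F(g,2)=\mathbf F_{g+1}-1$; (3) $\#\mathcal F(g,q)=\left\lfloor\frac{g+2q}{3}\right\rfloor+2$ if $\frac{2g+4}{5}<q\le\frac{g-1}{2}$ and $g\ge23$; (4) $\#\mathcal F(g,\frac g2)=\left\lfloor\frac{2g}{3}\right\rfloor+2$ if $g\equiv0\pmod2$ and $g\ge8$; (5) $\#\mathcal F(g,\frac{g+1}{2})=\left\lfloor\frac g3\right\rfloor+2$ if $g\equiv1\pmod2$ and $g\ge5$; (6) $\#\mathcal F(g,q)=2$ if $\frac{g+2}{2}\le q\le\frac{2g}{3}$; (7) $\#\mathcal F(g,\frac{2g+1}{3})=1$ if $g\equiv1\pmod3$ and $g\ge4$; (8) $\#\mathcal F(g,\frac{2g+2}{3})=0$ if $g\equiv2\pmod3$ and $g\ge5$; (9) $\#\mathcal F(g,q)=0$ if $\left\lceil\frac{2g}{3}\right\rceil+1\le q\le g-1$; (10) $\#\mathcal F(g,g)=1$; (11) $\#\mathcal F(g,q)=0$ if $q>g$.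
   Context: A gapset is a finite set $G\subset\mathbb N$ (positive integers) such that whenever $z\in G$ and $z=x+y$ with $x,y\in\mathbb N$, then $x\in G$ or $y\in G$. Its genus is $\#G$, its multiplicity is $m(G)=\min\{s\in\mathbb N_0\setminus G: s\ne0\}$, its conductor is $c(G)=\min\{s\in\mathbb N_0: s+n\notin G\ \forall n\in\mathbb N_0\}$, and its depth is $\lceil c(G)/m(G)\rceil$. The Fibonacci sequence is $\mathbf F_0=0$, $\mathbf F_1=1$, $\mathbf F_n=\mathbf F_{n-1}+\mathbf F_{n-2}$ for $n\ge2$. -}

module Defs where

open import Data.Nat using (ℕ; zero; suc; _+_; _*_; _∸_; _≤_; _<_; _/_)
open import Data.List using (List; length)
open import Data.List.Membership.Propositional using (_∈_; _∉_)
open import Data.List.Relation.Unary.All using (All)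
open import Data.List.Relation.Unary.Linked using (Linked)
open import Data.List.Relation.Unary.Unique.Propositional using (Unique)
open import Data.Product using (Σ; _×_)
open import Data.Sum using (_⊎_)
open import Relation.Binary.PropositionalEquality using (_≡_)

fib : ℕ → ℕ
fib zero = 0
fib (suc zero) = 1
fib (suc (suc n)) = fib (suc n) + fib n

-- ceiling division ⌈ c / m ⌉ (the value for m = 0 is irrelevant; set to 0)
ceilDiv : ℕ → ℕ → ℕ
ceilDiv c zero = 0
ceilDiv c (suc k) = (c + k) / suc k

-- A finite set of positive integers is represented canonically by the
-- strictly increasing list of its elements.
-- G is a gapset: elements positive, list strictly increasing (canonical
-- representation of the finite set), and closure under splitting.
IsGapset : List ℕ → Set
IsGapset G =
  All (λ z → 1 ≤ z) G ×
  Linked _<_ G ×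
  (∀ z → z ∈ G → ∀ x y → 1 ≤ x → 1 ≤ y → z ≡ x + y → x ∈ G ⊎ y ∈ G)

genus : List ℕ → ℕ
genus = length

IsMultiplicity : List ℕ → ℕ → Set
IsMultiplicity G m = 1 ≤ m × m ∉ G × (∀ s → 1 ≤ s → s < m → s ∈ G)

IsConductor : List ℕ → ℕ → Set
IsConductor G c =
  (∀ n → (c + n) ∉ G) ×
  (∀ s → s < c → Σ ℕ (λ n → (s + n) ∈ G))

HasDepth : List ℕ → ℕ → Set
HasDepth G q = Σ ℕ λ m → Σ ℕ λ c →
  IsMultiplicity G m × IsConductor G c × q ≡ ceilDiv c m

NumGapsets : ℕ → ℕ → ℕ → Set
NumGapsets g q n = Σ (List (List ℕ)) λ L →
  Unique L ×
  All (λ G → IsGapset G × genus G ≡ g × HasDepth G q) L ×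
  (∀ G → IsGapset G → genus G ≡ g → HasDepth G q → G ∈ L) ×
  length L ≡ n

{-# OPTIONS --safe #-}
-- A gapset of multiplicity m is encoded by its Kunz coordinates (k₁, …, k_{m-1}),
-- where kᵢ counts the gaps congruent to i modulo m.  The gapset property becomes
-- k_{a+b} ≤ k_a + k_b for a + b < m and k_{a+b-m} ≤ k_a + k_b + 1 for a + b > m;
-- the genus is the sum of the coordinates and the depth is their maximum q.
-- If kᵢ = q, pairing the other residues as a + b ≡ i gives
-- 2g ≥ 2q + (m - 2)(q - 1), so 5q ≥ 2g + 4 forces m ≤ 4 and the tuples with at
-- most three coordinates can be listed.  For m = 4 they form three families, according
-- to which coordinate attains q, each parametrised by an interval.  For depth 2
-- the Kunz inequalities are void, and one counts the compositions of g into parts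
-- 1 and 2 having a part 2.
module Submission where

open import Defs
open import Data.Bool using (Bool; true; false; _∧_; _∨_; if_then_else_)
open import Data.Fin using (Fin; zero; suc)
open import Data.List using (List; []; _∷_; _++_; map; length; applyUpTo; replicate; cartesianProductWith)
open import Data.List.Membership.DecPropositional using () renaming (_∈?_ to ∈-dec)
open import Data.List.Membership.Propositional using (_∈_; _∉_)
open import Data.List.Membership.Propositional.Properties
open import Data.List.Properties
  using (length-map; length-++; length-applyUpTo; applyUpTo-∷ʳ; ∷-injectiveˡ; ∷-injectiveʳ)
open import Data.List.Relation.Binary.Permutation.Propositional using (↭-sym; ↭⇒↭ₛ)
open import Data.List.Relation.Binary.Permutation.Propositional.Properties using (↭-length; ∈-resp-↭)
import Data.List.Relation.Binary.Permutation.Setoid.Properties as Permutation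
open import Data.List.Relation.Unary.All as All using (All; []; _∷_)
import Data.List.Relation.Unary.All.Properties as All
open import Data.List.Relation.Unary.AllPairs as AllPairs using (AllPairs; []; _∷_)
open import Data.List.Relation.Unary.Any using (Any; here; there)
import Data.List.Relation.Unary.Any.Properties as Any
open import Data.List.Relation.Unary.Linked using (Linked)
open import Data.List.Relation.Unary.Linked.Properties using (Linked⇒AllPairs; AllPairs⇒Linked)
open import Data.List.Relation.Unary.Unique.Propositional using (Unique)
import Data.List.Relation.Unary.Unique.Propositional.Properties as Unique
open import Data.Nat
open import Data.Nat.DivMod
  using (m≡m%n+[m/n]*n; m%n<n; [m+kn]%n≡m%n; m<n⇒m%n≡m; m<n⇒m/n≡0; +-distrib-/-∣ʳ; m*n/n≡m)
open import Data.Nat.Divisibility using (n∣m*n)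
open import Data.Nat.ListAction using (sum)
open import Data.Nat.ListAction.Properties using (sum-++)
open import Data.Nat.Properties
open import Data.List.Sort ≤-decTotalOrder using (sort; sort-↭; sort-↗)
open import Data.Nat.Tactic.RingSolver using (solve-∀)
open import Data.Product using (∃; ∃₂; _×_; _,_; proj₁; proj₂)
open import Data.Sum using (_⊎_; inj₁; inj₂; [_,_]′)
open import Data.Vec as Vec using (Vec; []; _∷_; lookup; zipWith; tabulate)
open import Function using (_∘_; id)
open import Relation.Binary using (tri<; tri≈; tri>)
open import Relation.Binary.PropositionalEquality hiding ([_])
open import Relation.Nullary using (¬_; Dec; yes; no; contradiction; ofʸ; ofⁿ)
open import Relation.Nullary.Decidable using (_×-dec_; _⊎-dec_; _→-dec_)
open import Relation.Unary using (Decidable)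

-- The case distinctions come from comparing `2 * q` with g. Three coordinates with maximum q force
-- 2q ≤ g + 1, and two coordinates with maximum q force g ≤ 2q and 3q ≤ 2g + 1. So below g/2 only
-- triples occur, from (g + 2)/2 on only pairs occur (apart from depth g), and at 2q = g and 2q = g
-- + 1 both contribute. The bound 5q ≥ 2g + 4 does two jobs. It rules out four coordinates. With s =
-- g - q it also reads 3q ≥ 2s + 4, which keeps the coordinates that are not on top within the
-- maximum, so that each family of triples is an unbroken interval. What remains is a long list of
-- linear implications in at most seven natural variables. They are settled by reflection: each is
-- stated as a formula and proved by evaluating a decision function. To stay linear and free of
-- subtraction, a difference is a new variable with an equation such as e + q = g, and a floor is a
-- variable enclosed by two inequalities.

-- A Fourier–Motzkin prover for linear arithmetic over ℕ

-- Coefficients of the variables, followed by the constant term.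
Form : ℕ → Set
Form n = Vec ℕ (suc n)

eval : ∀ {n} → Form n → Vec ℕ n → ℕ
eval (c ∷ []) [] = c
eval (c ∷ cs@(_ ∷ _)) (x ∷ ρ) = c * x + eval cs ρ

infixl 6 _+F_
infixl 7 _*F_

_+F_ : ∀ {n} → Form n → Form n → Form n
_+F_ = zipWith _+_

_*F_ : ∀ {n} → ℕ → Form n → Form n
k *F l = Vec.map (k *_) l

constF : ∀ {n} → ℕ → Form n
constF {zero} k = k ∷ []
constF {suc n} k = 0 ∷ constF k

varF : ∀ {n} → Fin n → Form n
varF zero = 1 ∷ constF 0
varF (suc i) = 0 ∷ varF i

eval-∷ : ∀ {n} c (cs : Form n) x ρ → eval (c ∷ cs) (x ∷ ρ) ≡ c * x + eval cs ρ
eval-∷ c (_ ∷ _) x ρ = refl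

eval-+F : ∀ {n} (l r : Form n) ρ → eval (l +F r) ρ ≡ eval l ρ + eval r ρ
eval-+F (a ∷ []) (b ∷ []) [] = refl
eval-+F (a ∷ l@(_ ∷ _)) (b ∷ r@(_ ∷ _)) (x ∷ ρ) =
  trans (cong ((a + b) * x +_) (eval-+F l r ρ)) (rearrange a b x (eval l ρ) (eval r ρ))
  where
  rearrange : ∀ a b x u v → (a + b) * x + (u + v) ≡ (a * x + u) + (b * x + v)
  rearrange = solve-∀

eval-*F : ∀ {n} k (l : Form n) ρ → eval (k *F l) ρ ≡ k * eval l ρ
eval-*F k (a ∷ []) [] = refl
eval-*F k (a ∷ l@(_ ∷ _)) (x ∷ ρ) =
  trans (cong (k * a * x +_) (eval-*F k l ρ)) (rearrange k a x (eval l ρ))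
  where
  rearrange : ∀ k a x u → k * a * x + k * u ≡ k * (a * x + u)
  rearrange = solve-∀

eval-constF : ∀ {n} k (ρ : Vec ℕ n) → eval (constF k) ρ ≡ k
eval-constF k [] = refl
eval-constF k (x ∷ ρ) = trans (eval-∷ 0 (constF k) x ρ) (eval-constF k ρ)

eval-varF : ∀ {n} (i : Fin n) ρ → eval (varF i) ρ ≡ lookup ρ i
eval-varF zero (x ∷ ρ) = trans (eval-∷ 1 (constF 0) x ρ)
  (trans (cong₂ _+_ (*-identityˡ x) (eval-constF 0 ρ)) (+-identityʳ x))
eval-varF (suc i) (x ∷ ρ) = trans (eval-∷ 0 (varF i) x ρ) (eval-varF i ρ)

-- Both sides have natural coefficients, so negative numbers never appear. A variable may then occur
-- on both sides, and `bounds` cancels the smaller multiple.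
Con : ℕ → Set
Con n = Form n × Form n

Holds : ∀ {n} → Vec ℕ n → Con n → Set
Holds ρ (l , r) = eval l ρ ≤ eval r ρ

infixr 5 _∷?_

-- Coefficientwise comparison suffices because the variables are natural numbers. Dropping such
-- constraints limits the growth of the system during elimination.
trivial : ∀ {n} → Form n → Form n → Bool
trivial (a ∷ []) (b ∷ []) = a ≤ᵇ b
trivial (a ∷ l@(_ ∷ _)) (b ∷ r@(_ ∷ _)) = (a ≤ᵇ b) ∧ trivial l r

_∷?_ : ∀ {n} → Con n → List (Con n) → List (Con n)
c ∷? cs = if trivial (proj₁ c) (proj₂ c) then cs else c ∷ cs

All-∷? : ∀ {n ρ} {c : Con n} {cs} → Holds ρ c → All (Holds ρ) cs → All (Holds ρ) (c ∷? cs)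
All-∷? {c = l , r} h hs with trivial l r
... | true = hs
... | false = h ∷ hs

-- With x the eliminated variable, (p , l , r) stands for  p x + l ≤ r  when
-- it is an upper bound and for  l ≤ p x + r  when it is a lower bound.
Bound : ℕ → Set
Bound n = ℕ × Con n

Upper Lower : ∀ {n} → ℕ → Vec ℕ n → Bound n → Set
Upper x ρ (p , l , r) = p * x + eval l ρ ≤ eval r ρ
Lower x ρ (p , l , r) = eval l ρ ≤ p * x + eval r ρ

-- A constraint with equal coefficients counts as an upper bound with multiplier 0, that is, as one
-- that does not mention the eliminated variable.
bounds : ∀ {n} → List (Con (suc n)) → List (Bound n) × List (Bound n)
bounds [] = [] , []
bounds ((a ∷ l , b ∷ r) ∷ cs) with bounds cs | b ≤ᵇ a
... | us , ls | true = (a ∸ b , l , r) ∷ us , ls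
... | us , ls | false = us , (b ∸ a , l , r) ∷ ls

private
  cancel : ∀ a b x l r → b ≤ a → a * x + l ≤ b * x + r → (a ∸ b) * x + l ≤ r
  cancel a b x l r b≤a h = +-cancelˡ-≤ (b * x) _ _ (begin
    b * x + ((a ∸ b) * x + l)  ≡⟨ +-assoc (b * x) _ l ⟨
    b * x + (a ∸ b) * x + l    ≡⟨ cong (_+ l) (*-distribʳ-+ x b (a ∸ b)) ⟨
    (b + (a ∸ b)) * x + l      ≡⟨ cong (λ k → k * x + l) (m+[n∸m]≡n b≤a) ⟩
    a * x + l                  ≤⟨ h ⟩
    b * x + r                  ∎)
    where open ≤-Reasoning

  cancel′ : ∀ a b x l r → a ≤ b → a * x + l ≤ b * x + r → l ≤ (b ∸ a) * x + r
  cancel′ a b x l r a≤b h = +-cancelˡ-≤ (a * x) _ _ (begin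
    a * x + l                  ≤⟨ h ⟩
    b * x + r                  ≡⟨ cong (λ k → k * x + r) (m+[n∸m]≡n a≤b) ⟨
    (a + (b ∸ a)) * x + r      ≡⟨ cong (_+ r) (*-distribʳ-+ x a (b ∸ a)) ⟩
    a * x + (b ∸ a) * x + r    ≡⟨ +-assoc (a * x) _ r ⟩
    a * x + ((b ∸ a) * x + r)  ∎)
    where open ≤-Reasoning

bounds-sound : ∀ {n x} {ρ : Vec ℕ n} cs → All (Holds (x ∷ ρ)) cs →
  All (Upper x ρ) (proj₁ (bounds cs)) × All (Lower x ρ) (proj₂ (bounds cs))
bounds-sound [] [] = [] , []
bounds-sound {x = x} {ρ} ((a ∷ l , b ∷ r) ∷ cs) (h ∷ hs)
  with bounds cs | bounds-sound cs hs | b ≤ᵇ a | ≤ᵇ-reflects-≤ b a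
     | subst₂ _≤_ (eval-∷ a l x ρ) (eval-∷ b r x ρ) h
... | us , ls | hu , hl | true  | ofʸ b≤a | h′ =
  cancel a b x (eval l ρ) (eval r ρ) b≤a h′ ∷ hu , hl
... | us , ls | hu , hl | false | ofⁿ b≰a | h′ =
  hu , cancel′ a b x (eval l ρ) (eval r ρ) (<⇒≤ (≰⇒> b≰a)) h′ ∷ hl

combine : ∀ {n} → Bound n → Bound n → Con n
combine (p , l , r) (p′ , l′ , r′) = p′ *F l +F p *F l′ , p′ *F r +F p *F r′

-- Scaling the upper bound by `p′` and the lower bound by `p` gives x the same coefficient `p * p′`
-- in both, so one can be chained into the other without division.
combine-sound : ∀ {n x} {ρ : Vec ℕ n} u v → Upper x ρ u → Lower x ρ v → Holds ρ (combine u v)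
combine-sound {x = x} {ρ} (p , l , r) (p′ , l′ , r′) hu hl = begin
  eval (p′ *F l +F p *F l′) ρ            ≡⟨ evals p′ l p l′ ⟩
  p′ * eval l ρ + p * eval l′ ρ          ≤⟨ +-monoʳ-≤ (p′ * eval l ρ) (*-monoʳ-≤ p hl) ⟩
  p′ * eval l ρ + p * (p′ * x + eval r′ ρ)  ≡⟨ swap p′ (eval l ρ) p x (eval r′ ρ) ⟩
  p′ * (p * x + eval l ρ) + p * eval r′ ρ  ≤⟨ +-monoˡ-≤ (p * eval r′ ρ) (*-monoʳ-≤ p′ hu) ⟩
  p′ * eval r ρ + p * eval r′ ρ          ≡⟨ evals p′ r p r′ ⟨
  eval (p′ *F r +F p *F r′) ρ            ∎
  where
  open ≤-Reasoning
  evals : ∀ a f b g → eval (a *F f +F b *F g) ρ ≡ a * eval f ρ + b * eval g ρ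
  evals a f b g = trans (eval-+F (a *F f) (b *F g) ρ) (cong₂ _+_ (eval-*F a f ρ) (eval-*F b g ρ))
  swap : ∀ a f b x g → a * f + b * (a * x + g) ≡ a * (b * x + f) + b * g
  swap = solve-∀

combineAll : ∀ {n} → Bound n → List (Bound n) → List (Con n) → List (Con n)
combineAll u [] cs = cs
combineAll u (v ∷ vs) cs = combine u v ∷? combineAll u vs cs

-- An upper bound is also kept without x, because x ≥ 0.
eliminate : ∀ {n} → List (Bound n) → List (Bound n) → List (Con n)
eliminate [] vs = []
eliminate (u@(zero , c) ∷ us) vs = c ∷? eliminate us vs
eliminate (u@(suc p , c) ∷ us) vs = c ∷? combineAll u vs (eliminate us vs)

combineAll-sound : ∀ {n x} {ρ : Vec ℕ n} {u vs cs} → Upper x ρ u → All (Lower x ρ) vs →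
  All (Holds ρ) cs → All (Holds ρ) (combineAll u vs cs)
combineAll-sound hu [] hs = hs
combineAll-sound {x = x} {u = u} {v ∷ vs} hu (hv ∷ hvs) hs =
  All-∷? {c = combine u v} (combine-sound {x = x} u v hu hv) (combineAll-sound {x = x} {u = u} hu hvs hs)

eliminate-sound : ∀ {n x} {ρ : Vec ℕ n} us vs → All (Upper x ρ) us → All (Lower x ρ) vs →
  All (Holds ρ) (eliminate us vs)
eliminate-sound [] vs [] hvs = []
eliminate-sound ((zero , c) ∷ us) vs (hu ∷ hus) hvs = All-∷? {c = c} hu (eliminate-sound us vs hus hvs)
eliminate-sound {x = x} {ρ} (u@(suc p , c@(l , r)) ∷ us) vs (hu ∷ hus) hvs =
  All-∷? {c = c} (m+n≤o⇒n≤o (suc p * x) hu)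
    (combineAll-sound {x = x} {u = u} hu hvs (eliminate-sound us vs hus hvs))

absurdity : List (Con 0) → Bool
absurdity [] = false
absurdity ((l ∷ [] , r ∷ []) ∷ cs) = (r <ᵇ l) ∨ absurdity cs

absurdity-sound : ∀ cs → absurdity cs ≡ true → ¬ All (Holds []) cs
absurdity-sound ((l ∷ [] , r ∷ []) ∷ cs) eq (h ∷ hs) with r <ᵇ l | <ᵇ-reflects-< r l
... | true | ofʸ r<l = <⇒≱ r<l h
... | false | _ = absurdity-sound cs eq hs

inconsistent : ∀ {n} → List (Con n) → Bool
inconsistent {zero} cs = absurdity cs
inconsistent {suc n} cs = inconsistent (eliminate (proj₁ (bounds cs)) (proj₂ (bounds cs)))

inconsistent-sound : ∀ {n} {ρ : Vec ℕ n} cs → inconsistent cs ≡ true → ¬ All (Holds ρ) cs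
inconsistent-sound {zero} {[]} cs eq hs = absurdity-sound cs eq hs
inconsistent-sound {suc n} {x ∷ ρ} cs eq hs with bounds-sound cs hs
... | hu , hl = inconsistent-sound (eliminate (proj₁ (bounds cs)) (proj₂ (bounds cs))) eq (eliminate-sound _ _ hu hl)

-- Linear formulas and their reduction to systems of inequalities

infixl 6 _⊕_
infixl 7 _⊛_
infix 4 _≦_ _≐_ _≺_
infixr 3 _&_
infixr 2 _∣∣_
infixr 1 _⇒_

data Expr (n : ℕ) : Set where
  var : Fin n → Expr n
  con : ℕ → Expr n
  _⊕_ : Expr n → Expr n → Expr n
  _⊛_ : ℕ → Expr n → Expr n

data Formula (n : ℕ) : Set where
  _≦_ _≐_ : Expr n → Expr n → Formula n
  _&_ _∣∣_ _⇒_ : Formula n → Formula n → Formula n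

_≺_ : ∀ {n} → Expr n → Expr n → Formula n
e ≺ f = con 1 ⊕ e ≦ f

falsum : ∀ {n} → Formula n
falsum = con 1 ≦ con 0

⟦_⟧ : ∀ {n} → Expr n → Vec ℕ n → ℕ
⟦ var i ⟧ ρ = lookup ρ i
⟦ con k ⟧ ρ = k
⟦ e ⊕ f ⟧ ρ = ⟦ e ⟧ ρ + ⟦ f ⟧ ρ
⟦ k ⊛ e ⟧ ρ = k * ⟦ e ⟧ ρ

_⊨_ : ∀ {n} → Vec ℕ n → Formula n → Set
ρ ⊨ (e ≦ f) = ⟦ e ⟧ ρ ≤ ⟦ f ⟧ ρ
ρ ⊨ (e ≐ f) = ⟦ e ⟧ ρ ≡ ⟦ f ⟧ ρ
ρ ⊨ (F & G) = (ρ ⊨ F) × (ρ ⊨ G)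
ρ ⊨ (F ∣∣ G) = (ρ ⊨ F) ⊎ (ρ ⊨ G)
ρ ⊨ (F ⇒ G) = ρ ⊨ F → ρ ⊨ G

-- Decidability supplies the classical steps constructively: splitting a negated conjunction or an
-- implication, and refuting a formula's negation to prove it.
⊨-dec : ∀ {n} (ρ : Vec ℕ n) F → Dec (ρ ⊨ F)
⊨-dec ρ (e ≦ f) = ⟦ e ⟧ ρ ≤? ⟦ f ⟧ ρ
⊨-dec ρ (e ≐ f) = ⟦ e ⟧ ρ ≟ ⟦ f ⟧ ρ
⊨-dec ρ (F & G) = ⊨-dec ρ F ×-dec ⊨-dec ρ G
⊨-dec ρ (F ∣∣ G) = ⊨-dec ρ F ⊎-dec ⊨-dec ρ G
⊨-dec ρ (F ⇒ G) = ⊨-dec ρ F →-dec ⊨-dec ρ G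

form : ∀ {n} → Expr n → Form n
form (var i) = varF i
form (con k) = constF k
form (e ⊕ f) = form e +F form f
form (k ⊛ e) = k *F form e

eval-form : ∀ {n} (e : Expr n) ρ → eval (form e) ρ ≡ ⟦ e ⟧ ρ
eval-form (var i) ρ = eval-varF i ρ
eval-form (con k) ρ = eval-constF k ρ
eval-form (e ⊕ f) ρ = trans (eval-+F (form e) (form f) ρ) (cong₂ _+_ (eval-form e ρ) (eval-form f ρ))
eval-form (k ⊛ e) ρ = trans (eval-*F k (form e) ρ) (cong (k *_) (eval-form e ρ))

-- Disjunctive normal forms of a formula (true) and of its negation (false).
dnf : ∀ {n} → Bool → Formula n → List (List (Con n))
dnf true (e ≦ f) = ((form e , form f) ∷ []) ∷ []
dnf false (e ≦ f) = ((constF 1 +F form f , form e) ∷ []) ∷ []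
dnf true (e ≐ f) = ((form e , form f) ∷ (form f , form e) ∷ []) ∷ []
dnf false (e ≐ f) = ((constF 1 +F form f , form e) ∷ []) ∷ ((constF 1 +F form e , form f) ∷ []) ∷ []
dnf true (F & G) = cartesianProductWith _++_ (dnf true F) (dnf true G)
dnf false (F & G) = dnf false F ++ dnf false G
dnf true (F ∣∣ G) = dnf true F ++ dnf true G
dnf false (F ∣∣ G) = cartesianProductWith _++_ (dnf false F) (dnf false G)
dnf true (F ⇒ G) = dnf false F ++ dnf true G
dnf false (F ⇒ G) = cartesianProductWith _++_ (dnf true F) (dnf false G)

Signed : Bool → Set → Set
Signed true A = A
Signed false A = ¬ A

Satisfied : ∀ {n} → Vec ℕ n → List (List (Con n)) → Set
Satisfied ρ = Any (All (Holds ρ))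

private
  atom : ∀ {n} (ρ : Vec ℕ n) e f → ⟦ e ⟧ ρ ≤ ⟦ f ⟧ ρ → Holds ρ (form e , form f)
  atom ρ e f = subst₂ _≤_ (sym (eval-form e ρ)) (sym (eval-form f ρ))

  atom< : ∀ {n} (ρ : Vec ℕ n) e f → ⟦ e ⟧ ρ < ⟦ f ⟧ ρ → Holds ρ (constF 1 +F form e , form f)
  atom< ρ e f = atom ρ (con 1 ⊕ e) f

  both : ∀ {n} {ρ : Vec ℕ n} {C D} → Satisfied ρ C → Satisfied ρ D → Satisfied ρ (cartesianProductWith _++_ C D)
  both = Any.cartesianProductWith⁺ _++_ All.++⁺

dnf-sound : ∀ {n} b (ρ : Vec ℕ n) F → Signed b (ρ ⊨ F) → Satisfied ρ (dnf b F)
dnf-sound true ρ (e ≦ f) h = here (atom ρ e f h ∷ [])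
dnf-sound false ρ (e ≦ f) h = here (atom< ρ f e (≰⇒> h) ∷ [])
dnf-sound true ρ (e ≐ f) h = here (atom ρ e f (≤-reflexive h) ∷ atom ρ f e (≤-reflexive (sym h)) ∷ [])
dnf-sound false ρ (e ≐ f) h with <-cmp (⟦ e ⟧ ρ) (⟦ f ⟧ ρ)
... | tri< lt _ _ = there (here (atom< ρ e f lt ∷ []))
... | tri≈ _ eq _ = contradiction eq h
... | tri> _ _ gt = here (atom< ρ f e gt ∷ [])
dnf-sound true ρ (F & G) (h , k) = both (dnf-sound true ρ F h) (dnf-sound true ρ G k)
dnf-sound false ρ (F & G) h with ⊨-dec ρ F
... | yes x = Any.++⁺ʳ (dnf false F) (dnf-sound false ρ G (λ y → h (x , y)))
... | no ¬x = Any.++⁺ˡ (dnf-sound false ρ F ¬x)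
dnf-sound true ρ (F ∣∣ G) (inj₁ h) = Any.++⁺ˡ (dnf-sound true ρ F h)
dnf-sound true ρ (F ∣∣ G) (inj₂ h) = Any.++⁺ʳ (dnf true F) (dnf-sound true ρ G h)
dnf-sound false ρ (F ∣∣ G) h = both (dnf-sound false ρ F (h ∘ inj₁)) (dnf-sound false ρ G (h ∘ inj₂))
dnf-sound true ρ (F ⇒ G) h with ⊨-dec ρ F
... | yes x = Any.++⁺ʳ (dnf false F) (dnf-sound true ρ G (h x))
... | no ¬x = Any.++⁺ˡ (dnf-sound false ρ F ¬x)
dnf-sound false ρ (F ⇒ G) h with ⊨-dec ρ F
... | yes x = both (dnf-sound true ρ F x) (dnf-sound false ρ G (λ y → h (λ _ → y)))
... | no ¬x = contradiction (λ x → contradiction x ¬x) h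

unsatisfiable : ∀ {n} → List (List (Con n)) → Bool
unsatisfiable [] = true
unsatisfiable (c ∷ cs) = inconsistent c ∧ unsatisfiable cs

unsatisfiable-sound : ∀ {n} {ρ : Vec ℕ n} cs → unsatisfiable cs ≡ true → ¬ Satisfied ρ cs
unsatisfiable-sound (c ∷ cs) eq h with inconsistent c in eq′
unsatisfiable-sound (c ∷ cs) eq (here h) | true = inconsistent-sound c eq′ h
unsatisfiable-sound (c ∷ cs) eq (there h) | true = unsatisfiable-sound cs eq h

Fun : ℕ → Set → Set → Set
Fun zero A B = B
Fun (suc n) A B = A → Fun n A B

apply : ∀ {n A B} → Fun n A B → Vec A n → B
apply f [] = f
apply f (x ∷ xs) = apply (f x) xs

Forall : ∀ n → (Vec ℕ n → Set) → Set
Forall zero P = P []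
Forall (suc n) P = ∀ x → Forall n (P ∘ (x ∷_))

curryⁿ : ∀ n {P : Vec ℕ n → Set} → (∀ ρ → P ρ) → Forall n P
curryⁿ zero f = f []
curryⁿ (suc n) f x = curryⁿ n (f ∘ (x ∷_))

-- The negation of F, in disjunctive normal form, is refuted one disjunct at a time. Elimination
-- itself is the rational one; integrality enters only where a strict inequality becomes
-- `1 + _ ≤ _`. The equation is closed by `refl` whenever the refutation succeeds by evaluation.
linear : ∀ n (f : Fun n (Expr n) (Formula n)) →
  let F = apply f (tabulate var) in
  unsatisfiable (dnf false F) ≡ true → Forall n (_⊨ F)
linear n f eq = curryⁿ n λ ρ → decide ρ (⊨-dec ρ F)
  where
  F = apply f (tabulate var)
  decide : ∀ ρ → Dec (ρ ⊨ F) → ρ ⊨ F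
  decide ρ (yes h) = h
  decide ρ (no ¬h) = contradiction (dnf-sound false ρ F ¬h) (unsatisfiable-sound (dnf false F) eq)

-- Counting the elements of a predicate

record Count {A : Set} (P : A → Set) (n : ℕ) : Set where
  constructor counting
  field
    elements : List A
    unique   : Unique elements
    sound    : ∀ {x} → x ∈ elements → P x
    complete : ∀ {x} → P x → x ∈ elements
    size     : length elements ≡ n

open Count

module _ {A : Set} where

  count-cong : ∀ {P Q : A → Set} {n} → (∀ {x} → P x → Q x) → (∀ {x} → Q x → P x) →
    Count P n → Count Q n
  count-cong to from C = counting (elements C) (unique C) (to ∘ sound C) (complete C ∘ from) (size C)

  count-none : {P : A → Set} → (∀ {x} → ¬ P x) → Count P 0
  count-none ¬P = counting [] [] (λ ()) (λ p → contradiction p ¬P) refl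

  count-one : ∀ {P : A → Set} x → P x → (∀ {y} → P y → y ≡ x) → Count P 1
  count-one x px only = counting (x ∷ []) ([] ∷ []) (λ { (here refl) → px }) (here ∘ only) refl

  count-⊎ : ∀ {P Q : A → Set} {m n} → (∀ {x} → P x → ¬ Q x) →
    Count P m → Count Q n → Count (λ x → P x ⊎ Q x) (m + n)
  count-⊎ disjoint C D = counting
    (elements C ++ elements D)
    (Unique.++⁺ (unique C) (unique D) (λ (p , q) → disjoint (sound C p) (sound D q)))
    (λ x∈ → [ inj₁ ∘ sound C , inj₂ ∘ sound D ]′ (∈-++⁻ (elements C) x∈))
    [ ∈-++⁺ˡ ∘ complete C , ∈-++⁺ʳ (elements C) ∘ complete D ]′
    (trans (length-++ (elements C)) (cong₂ _+_ (size C) (size D)))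

  unique-map : ∀ {B : Set} {P : A → Set} {f : A → B} → (∀ {x y} → P x → P y → f x ≡ f y → x ≡ y) →
    ∀ {xs} → All P xs → Unique xs → Unique (map f xs)
  unique-map inj [] [] = []
  unique-map inj (p ∷ ps) (x∉ ∷ u) =
    All.map⁺ (All.zipWith (λ (q , x≢y) → x≢y ∘ inj p q) (ps , x∉)) ∷ unique-map inj ps u

  -- Injectivity is required only on P because `gaps` is injective on lists with positive entries
  -- but not on all lists: zero entries at the end are invisible.
  count-map : ∀ {B : Set} {P : A → Set} {n} (f : A → B) → (∀ {x y} → P x → P y → f x ≡ f y → x ≡ y) →
    Count P n → Count (λ y → ∃ λ x → P x × y ≡ f x) n
  count-map f inj C = counting
    (map f (elements C))
    (unique-map inj (All.tabulate (sound C)) (unique C))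
    (λ y∈ → let x , x∈ , eq = ∈-map⁻ f y∈ in x , sound C x∈ , eq)
    (λ (x , px , eq) → subst (_∈ _) (sym eq) (∈-map⁺ f (complete C px)))
    (trans (length-map f (elements C)) (size C))

count-interval : ∀ lo n → Count (λ b → lo ≤ b × b < lo + n) n
count-interval lo n = counting
  (applyUpTo (lo +_) n)
  (Unique.applyUpTo⁺₁ (lo +_) n (λ i<j _ → <⇒≢ (+-monoʳ-< lo i<j)))
  (λ b∈ → let i , i<n , eq = ∈-applyUpTo⁻ (lo +_) b∈ in
    subst (λ b → lo ≤ b × b < lo + n) (sym eq) (m≤m+n lo i , +-monoʳ-< lo i<n))
  (λ {b} (lo≤b , b<) → subst (_∈ _) (m+[n∸m]≡n lo≤b)
    (∈-applyUpTo⁺ (lo +_) (+-cancelˡ-< lo _ _ (subst (_< lo + n) (sym (m+[n∸m]≡n lo≤b)) b<))))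
  (length-applyUpTo (lo +_) n)

-- Kunz coordinates

at : List ℕ → ℕ → ℕ
at [] _ = 0
at (k ∷ ks) zero = k
at (k ∷ ks) (suc i) = at ks i

at-applyUpTo : ∀ f {n i} → i < n → at (applyUpTo f n) i ≡ f i
at-applyUpTo f {suc n} {zero} _ = refl
at-applyUpTo f {suc n} {suc i} (s≤s i<n) = at-applyUpTo (f ∘ suc) i<n

at-∈ : ∀ ks {i} → i < length ks → at ks i ∈ ks
at-∈ (k ∷ ks) {zero} _ = here refl
at-∈ (k ∷ ks) {suc i} (s≤s i<n) = there (at-∈ ks i<n)

∈-at : ∀ {ks k} → k ∈ ks → ∃ λ i → i < length ks × k ≡ at ks i
∈-at (here eq) = 0 , s≤s z≤n , eq
∈-at (there k∈) = let i , i< , eq = ∈-at k∈ in suc i , s≤s i< , eq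

at-ext : ∀ {ks ls} → length ks ≡ length ls → (∀ i → i < length ks → at ks i ≡ at ls i) → ks ≡ ls
at-ext {[]} {[]} _ _ = refl
at-ext {k ∷ ks} {l ∷ ls} eq f =
  cong₂ _∷_ (f 0 (s≤s z≤n)) (at-ext (suc-injective eq) (λ i i< → f (suc i) (s≤s i<)))

divmod-unique : ∀ {m a b} j k → a < m → b < m → a + j * m ≡ b + k * m → a ≡ b × j ≡ k
divmod-unique {m@(suc _)} {a} {b} j k a<m b<m eq = a≡b ,
  *-cancelʳ-≡ j k m (+-cancelˡ-≡ a _ _ (trans eq (cong (_+ k * m) (sym a≡b))))
  where
  a≡b : a ≡ b
  a≡b = begin
    a                ≡⟨ m<n⇒m%n≡m a<m ⟨
    a % m            ≡⟨ [m+kn]%n≡m%n a j m ⟨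
    (a + j * m) % m  ≡⟨ cong (_% m) eq ⟩
    (b + k * m) % m  ≡⟨ [m+kn]%n≡m%n b k m ⟩
    b % m            ≡⟨ m<n⇒m%n≡m b<m ⟩
    b                ∎
    where open ≡-Reasoning

-- A view of division with remainder: matching on it replaces a number by `a + j * m`, so that later
-- arguments handle residue and quotient without `_%_` and `_/_`.
data Split (m : ℕ) : ℕ → Set where
  split-at : ∀ {a} → a < m → ∀ j → Split m (a + j * m)

splitting : ∀ n x → Split (suc n) x
splitting n x = subst (Split (suc n)) (sym (m≡m%n+[m/n]*n x (suc n))) (split-at (m%n<n x (suc n)) (x / suc n))

column : ℕ → ℕ → ℕ → List ℕ
column m a k = applyUpTo (λ j → a + j * m) k

columns : ℕ → ℕ → List ℕ → List ℕ
columns m a [] = []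
columns m a (k ∷ ks) = column m a k ++ columns m (suc a) ks

length-columns : ∀ m a ks → length (columns m a ks) ≡ sum ks
length-columns m a [] = refl
length-columns m a (k ∷ ks) = trans (length-++ (column m a k))
  (cong₂ _+_ (length-applyUpTo (λ j → a + j * m) k) (length-columns m (suc a) ks))

∈-columns⁺ : ∀ {m} a ks i {j} → j < at ks i → a + i + j * m ∈ columns m a ks
∈-columns⁺ {m} a (k ∷ ks) zero {j} j<k =
  ∈-++⁺ˡ (subst (λ b → b + j * m ∈ column m a k) (sym (+-identityʳ a)) (∈-applyUpTo⁺ (λ j → a + j * m) j<k))
∈-columns⁺ {m} a (k ∷ ks) (suc i) {j} j< =
  ∈-++⁺ʳ (column m a k) (subst (λ b → b + j * m ∈ columns m (suc a) ks) (sym (+-suc a i)) (∈-columns⁺ (suc a) ks i j<))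

∈-columns⁻ : ∀ {m} a ks {x} → x ∈ columns m a ks →
  ∃₂ λ i j → i < length ks × j < at ks i × x ≡ a + i + j * m
∈-columns⁻ {m} a (k ∷ ks) x∈ with ∈-++⁻ (column m a k) x∈
... | inj₁ x∈k = let j , j<k , eq = ∈-applyUpTo⁻ _ x∈k in
  0 , j , s≤s z≤n , j<k , trans eq (cong (_+ j * m) (sym (+-identityʳ a)))
... | inj₂ x∈ks = let i , j , i< , j< , eq = ∈-columns⁻ (suc a) ks x∈ks in
  suc i , j , s≤s i< , j< , trans eq (cong (_+ j * m) (sym (+-suc a i)))

columns-unique : ∀ {m} a ks → a + length ks ≤ m → Unique (columns m a ks)
columns-unique a [] _ = []
columns-unique {m} a (k ∷ ks) a+l≤m = Unique.++⁺
  (Unique.applyUpTo⁺₁ _ k (λ {i} {j} i<j _ eq → <⇒≢ i<j (proj₂ (divmod-unique i j a<m a<m eq))))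
  (columns-unique (suc a) ks (subst (_≤ m) (+-suc a (length ks)) a+l≤m))
  (λ (x∈k , x∈ks) →
    let j , _ , eq = ∈-applyUpTo⁻ _ x∈k
        i , j′ , i< , _ , eq′ = ∈-columns⁻ (suc a) ks x∈ks
        sa+i<m = linear 4 (λ a i l m → a ⊕ (con 1 ⊕ l) ≦ m ⇒ i ≺ l ⇒ con 1 ⊕ a ⊕ i ≺ m) refl
          a i (length ks) m a+l≤m i<
    in m≢1+m+n a (proj₁ (divmod-unique j j′ a<m sa+i<m (trans (sym eq) eq′))))
  where
  a<m = linear 3 (λ a l m → a ⊕ (con 1 ⊕ l) ≦ m ⇒ a ≺ m) refl a (length ks) m a+l≤m

multiplicity : List ℕ → ℕ
multiplicity ks = suc (length ks)

-- Prepending k₀ = 0 makes the index equal to the residue and records that no multiple of m is a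
-- gap.
coordinate : List ℕ → ℕ → ℕ
coordinate ks = at (0 ∷ ks)

-- The gaps congruent to i modulo m are i, i + m, …, i + (kᵢ - 1) m.
gaps : List ℕ → List ℕ
gaps ks = sort (columns (multiplicity ks) 0 (0 ∷ ks))

module _ (ks : List ℕ) where
  private m = multiplicity ks

  length-gaps : length (gaps ks) ≡ sum ks
  length-gaps = trans (↭-length (sort-↭ _)) (length-columns m 0 (0 ∷ ks))

  -- Sorting gives only the weak order. Strictness comes from the distinctness of the column
  -- entries, that is, from uniqueness of division with remainder.
  gaps-sorted : Linked _<_ (gaps ks)
  gaps-sorted = AllPairs⇒Linked (AllPairs.zipWith (λ (le , ne) → ≤∧≢⇒< le ne)
    ( Linked⇒AllPairs ≤-trans (sort-↗ _)
    , Permutation.Unique-resp-↭ (setoid ℕ) (↭⇒↭ₛ (↭-sym (sort-↭ _))) (columns-unique 0 (0 ∷ ks) ≤-refl)))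

  ∈-gaps⁺ : ∀ a {j} → j < coordinate ks a → a + j * m ∈ gaps ks
  ∈-gaps⁺ a j< = ∈-resp-↭ (↭-sym (sort-↭ _)) (∈-columns⁺ 0 (0 ∷ ks) a j<)

  ∈-gaps⁻ : ∀ {a} → a < m → ∀ j → a + j * m ∈ gaps ks → j < coordinate ks a
  ∈-gaps⁻ a<m j x∈ with ∈-columns⁻ 0 (0 ∷ ks) (∈-resp-↭ (sort-↭ _) x∈)
  ... | i , j′ , i<m , j′< , eq with divmod-unique j j′ a<m i<m eq
  ... | refl , refl = j′<

-- The wrapped residue c is quantified over instead of being computed by subtraction. This admits a
-- + b = m with c = 0, where the inequality is trivial since k₀ = 0.
Kunz : List ℕ → Set
Kunz ks =
  (∀ a b → a + b < multiplicity ks → coordinate ks (a + b) ≤ coordinate ks a + coordinate ks b) ×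
  (∀ a b c → a < multiplicity ks → b < multiplicity ks → a + b ≡ multiplicity ks + c →
    coordinate ks c ≤ suc (coordinate ks a + coordinate ks b))

Positive : List ℕ → Set
Positive = All (1 ≤_)

coordinate-positive : ∀ {ks} → Positive ks → ∀ {a} → 1 ≤ a → a < multiplicity ks → 1 ≤ coordinate ks a
coordinate-positive {ks} pos {suc a} _ (s≤s a<) = All.lookup pos (at-∈ ks a<)

gaps-positive : ∀ ks → All (1 ≤_) (gaps ks)
gaps-positive ks = All.tabulate λ {x} → go (splitting (length ks) x)
  where
  go : ∀ {x} → Split (multiplicity ks) x → x ∈ gaps ks → 1 ≤ x
  go (split-at {zero} a<m j) x∈ = contradiction (∈-gaps⁻ ks a<m j x∈) λ ()
  go (split-at {suc a} a<m j) x∈ = s≤s z≤n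

multiplicity∉gaps : ∀ ks → multiplicity ks ∉ gaps ks
multiplicity∉gaps ks m∈ =
  contradiction (∈-gaps⁻ ks {0} (s≤s z≤n) 1 (subst (_∈ gaps ks) (sym (*-identityˡ _)) m∈)) λ ()

gaps-multiplicity : ∀ {ks} → Positive ks → IsMultiplicity (gaps ks) (multiplicity ks)
gaps-multiplicity {ks} pos = s≤s z≤n , multiplicity∉gaps ks , λ s 1≤s s<m →
  subst (_∈ gaps ks) (+-identityʳ s) (∈-gaps⁺ ks s (coordinate-positive pos 1≤s s<m))

private
  carry : ∀ a b i j m → a + i * m + (b + j * m) ≡ a + b + (i + j) * m
  carry = solve-∀

  carry′ : ∀ a b c i j m → a + b ≡ m + c → a + i * m + (b + j * m) ≡ c + suc (i + j) * m
  carry′ a b c i j m eq = trans (carry a b i j m) (trans (cong (_+ (i + j) * m) eq) (rearrange m c ((i + j) * m)))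
    where
    rearrange : ∀ m c n → m + c + n ≡ c + (m + n)
    rearrange = solve-∀

-- If neither summand is a gap, the quotients satisfy i ≥ kₐ and j ≥ k_b. The quotient of the sum is
-- i + j, or i + j + 1 after a carry, and the matching Kunz inequality puts it at or above the
-- height of its column.
kunz⇒gapset : ∀ {ks} → Kunz ks → IsGapset (gaps ks)
kunz⇒gapset {ks} (K₁ , K₂) = gaps-positive ks , gaps-sorted ks ,
  λ z z∈ x y _ _ eq → go (splitting (length ks) x) (splitting (length ks) y) (subst (_∈ gaps ks) eq z∈)
  where
  m = multiplicity ks
  go : ∀ {x y} → Split m x → Split m y → x + y ∈ gaps ks → x ∈ gaps ks ⊎ y ∈ gaps ks
  go (split-at {a} a<m i) (split-at {b} b<m j) z∈ with i <? coordinate ks a | j <? coordinate ks b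
  ... | yes i< | _ = inj₁ (∈-gaps⁺ ks a i<)
  ... | no _ | yes j< = inj₂ (∈-gaps⁺ ks b j<)
  ... | no i≮ | no j≮ with a + b <? m
  ... | yes a+b<m = contradiction (K₁ a b a+b<m)
    (<⇒≱ (≤-<-trans (+-mono-≤ (≮⇒≥ i≮) (≮⇒≥ j≮)) (∈-gaps⁻ ks a+b<m (i + j) (subst (_∈ gaps ks) (carry a b i j m) z∈))))
  ... | no a+b≮m = contradiction (K₂ a b c a<m b<m (sym m+c))
    (<⇒≱ (≤-<-trans (s≤s (+-mono-≤ (≮⇒≥ i≮) (≮⇒≥ j≮))) (∈-gaps⁻ ks c<m (suc (i + j))
      (subst (_∈ gaps ks) (carry′ a b c i j m (sym m+c)) z∈))))
    where
    c = a + b ∸ m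
    m+c : m + c ≡ a + b
    m+c = m+[n∸m]≡n (≮⇒≥ a+b≮m)
    c<m : c < m
    c<m = linear 4 (λ a b c m → a ≺ m ⇒ b ≺ m ⇒ m ⊕ c ≐ a ⊕ b ⇒ c ≺ m) refl a b c m a<m b<m m+c

-- The number `a + k a * m` is the least non-gap in its class. A violated inequality would make the
-- sum of two such numbers a gap, though neither summand is one. Residue 0 is treated apart because
-- there this number is 0, which is not an admissible summand.
gapset⇒kunz : ∀ {ks} → IsGapset (gaps ks) → Kunz ks
gapset⇒kunz {ks} (_ , _ , split′) = K₁ , K₂
  where
  m = multiplicity ks
  k = coordinate ks
  top∉ : ∀ {a} → a < m → a + k a * m ∉ gaps ks
  top∉ {a} a<m x∈ = <-irrefl refl (∈-gaps⁻ ks a<m (k a) x∈)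
  K₁ : ∀ a b → a + b < m → k (a + b) ≤ k a + k b
  K₁ zero b _ = ≤-refl
  K₁ (suc a) zero _ = ≤-trans (≤-reflexive (cong k (+-identityʳ (suc a)))) (m≤m+n _ 0)
  K₁ a@(suc _) b@(suc _) a+b<m = ≮⇒≥ λ lt →
    [ top∉ (≤-<-trans (m≤m+n a b) a+b<m) , top∉ (≤-<-trans (m≤n+m b a) a+b<m) ]′
      (split′ _ (∈-gaps⁺ ks (a + b) lt) (a + k a * m) (b + k b * m) (s≤s z≤n) (s≤s z≤n)
        (sym (carry a b (k a) (k b) m)))
  K₂ : ∀ a b c → a < m → b < m → a + b ≡ m + c → k c ≤ suc (k a + k b)
  K₂ zero b c _ b<m eq = contradiction b<m (≤⇒≯ (subst (m ≤_) (sym eq) (m≤m+n m c)))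
  K₂ (suc a) zero c a<m _ eq =
    contradiction a<m (≤⇒≯ (subst (m ≤_) (trans (sym eq) (+-identityʳ (suc a))) (m≤m+n m c)))
  K₂ a@(suc _) b@(suc _) c a<m b<m eq = ≮⇒≥ λ lt →
    [ top∉ a<m , top∉ b<m ]′
      (split′ _ (∈-gaps⁺ ks c lt) (a + k a * m) (b + k b * m) (s≤s z≤n) (s≤s z≤n)
        (sym (carry′ a b c (k a) (k b) m eq)))

multiplicity-unique : ∀ {G m n} → IsMultiplicity G m → IsMultiplicity G n → m ≡ n
multiplicity-unique {m = m} {n} (1≤m , m∉ , below-m) (1≤n , n∉ , below-n) with <-cmp m n
... | tri< m<n _ _ = contradiction (below-n m 1≤m m<n) m∉
... | tri≈ _ eq _ = eq
... | tri> _ _ n<m = contradiction (below-m n 1≤n n<m) n∉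

gaps-injective : ∀ {ks ls} → Positive ks → Positive ls → gaps ks ≡ gaps ls → ks ≡ ls
gaps-injective {ks} {ls} pos pos′ eq = at-ext (suc-injective same-m) λ i i< → ≤-antisym
  (≮⇒≥ λ lt → <-irrefl refl (transfer ks ls eq same-m (s≤s i<) lt))
  (≮⇒≥ λ lt → <-irrefl refl (transfer ls ks (sym eq) (sym same-m) (subst (suc i <_) same-m (s≤s i<)) lt))
  where
  same-m : multiplicity ks ≡ multiplicity ls
  same-m = multiplicity-unique (gaps-multiplicity pos) (subst (λ G → IsMultiplicity G _) (sym eq) (gaps-multiplicity pos′))
  transfer : ∀ ks ls → gaps ks ≡ gaps ls → multiplicity ks ≡ multiplicity ls →
    ∀ {a j} → a < multiplicity ks → j < coordinate ks a → j < coordinate ls a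
  transfer ks ls eq same {a} {j} a<m j< = ∈-gaps⁻ ls (subst (a <_) same a<m) j
    (subst₂ (λ m G → a + j * m ∈ G) same eq (∈-gaps⁺ ks a j<))

-- Depth as the largest coordinate

maximum : ∀ G {x : ℕ} → x ∈ G → ∃ λ y → y ∈ G × (∀ z → z ∈ G → z ≤ y)
maximum (x ∷ []) _ = x , here refl , λ { z (here refl) → ≤-refl }
maximum (x ∷ G@(_ ∷ _)) _ with maximum G (here refl)
... | y , y∈ , y-max with ≤-total x y
... | inj₁ x≤y = y , there y∈ , λ { z (here refl) → x≤y ; z (there z∈) → y-max z z∈ }
... | inj₂ y≤x = x , here refl , λ { z (here refl) → ≤-refl ; z (there z∈) → ≤-trans (y-max z z∈) y≤x }

conductor⇒maximum : ∀ {G c x} → IsConductor G c → x ∈ G →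
  ∃ λ y → c ≡ suc y × y ∈ G × (∀ z → z ∈ G → z ≤ y)
conductor⇒maximum {G} {zero} {x} (above , _) x∈ = contradiction x∈ (above x)
conductor⇒maximum {G} {suc y} (above , below) _ = y , refl , y∈ , λ z z∈ → ≮⇒≥ λ y<z →
  above (z ∸ suc y) (subst (_∈ G) (sym (m+[n∸m]≡n y<z)) z∈)
  where
  y∈ : y ∈ G
  y∈ with below y ≤-refl
  ... | zero , p = subst (_∈ G) (+-identityʳ y) p
  ... | suc n , p = contradiction (subst (_∈ G) (+-suc y n) p) (above n)

maximum⇒conductor : ∀ {G y} → y ∈ G → (∀ z → z ∈ G → z ≤ y) → IsConductor G (suc y)
maximum⇒conductor {G} {y} y∈ y-max =
  (λ n p → m+1+n≰m y (subst (_≤ y) (sym (+-suc y n)) (y-max _ p))) ,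
  λ s s<1+y → y ∸ s , subst (_∈ G) (sym (m+[n∸m]≡n (≤-pred s<1+y))) y∈

ceilDiv-suc : ∀ {m a} j → a < m → ceilDiv (suc (a + j * m)) m ≡ suc j
ceilDiv-suc {suc n} {a} j a<m = begin
  (suc (a + j * suc n) + n) / suc n  ≡⟨ cong (_/ suc n) (rearrange a j n) ⟩
  (a + suc j * suc n) / suc n        ≡⟨ +-distrib-/-∣ʳ a (n∣m*n (suc j)) ⟩
  a / suc n + suc j * suc n / suc n  ≡⟨ cong₂ _+_ (m<n⇒m/n≡0 a<m) (m*n/n≡m (suc j) (suc n)) ⟩
  suc j                              ∎
  where
  open ≡-Reasoning
  rearrange : ∀ a j n → suc (a + j * suc n) + n ≡ a + suc j * suc n
  rearrange = solve-∀

IsMaximum : List ℕ → ℕ → Set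
IsMaximum ks q = All (_≤ q) ks × q ∈ ks

coordinate-∈ : ∀ {ks a j} → a < multiplicity ks → j < coordinate ks a → coordinate ks a ∈ ks
coordinate-∈ {a = zero} _ ()
coordinate-∈ {ks} {suc a} (s≤s a<) _ = at-∈ ks a<

-- Write the largest gap as a + jm. Its column has height exactly j + 1, and a column b of greater
-- height would contain b + (j + 1)m, which exceeds a + jm because a < m. The conductor a + jm + 1
-- divided by m rounds up to the same j + 1.
top-gap : ∀ ks {y} → y ∈ gaps ks → (∀ z → z ∈ gaps ks → z ≤ y) →
  IsMaximum ks (ceilDiv (suc y) (multiplicity ks))
top-gap ks {y} y∈ y-max = go (splitting (length ks) y) y∈ y-max
  where
  m = multiplicity ks
  go : ∀ {y} → Split m y → y ∈ gaps ks → (∀ z → z ∈ gaps ks → z ≤ y) → IsMaximum ks (ceilDiv (suc y) m)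
  go (split-at {a} a<m j) y∈ y-max = subst (IsMaximum ks) (sym (ceilDiv-suc j a<m))
    (All.tabulate (λ k∈ → let i , i< , eq = ∈-at k∈ in subst (_≤ suc j) (sym eq) (bound (suc i) (s≤s i<))) ,
     subst (_∈ ks) (≤-antisym (bound a a<m) j<) (coordinate-∈ {ks} a<m j<))
    where
    j< : j < coordinate ks a
    j< = ∈-gaps⁻ ks a<m j y∈
    bound : ∀ b → b < m → coordinate ks b ≤ suc j
    bound b b<m = ≮⇒≥ λ lt → <⇒≱ (begin-strict
      a + j * m        <⟨ +-monoˡ-< (j * m) a<m ⟩
      m + j * m        ≤⟨ m≤n+m _ b ⟩
      b + suc j * m    ∎) (y-max _ (∈-gaps⁺ ks b lt))
      where open ≤-Reasoning

IsMaximum-unique : ∀ {ks p q} → IsMaximum ks p → IsMaximum ks q → p ≡ q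
IsMaximum-unique (p-max , p∈) (q-max , q∈) = ≤-antisym (All.lookup q-max p∈) (All.lookup p-max q∈)

maximum⇒depth : ∀ {ks q} → Positive ks → IsMaximum ks q → HasDepth (gaps ks) q
maximum⇒depth {ks} {q} pos q-max =
  let i , i< , eq = ∈-at (proj₂ q-max)
      0<q = All.lookup pos (proj₂ q-max)
      y , y∈ , y-max = maximum (gaps ks) (∈-gaps⁺ ks (suc i) (subst (0 <_) eq 0<q))
  in multiplicity ks , suc y , gaps-multiplicity pos , maximum⇒conductor y∈ y-max ,
     IsMaximum-unique q-max (top-gap ks y∈ y-max)

depth⇒maximum : ∀ {ks q x} → Positive ks → x ∈ gaps ks → HasDepth (gaps ks) q → IsMaximum ks q
depth⇒maximum {ks} pos x∈ (m , c , is-m , is-c , refl)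
  rewrite multiplicity-unique is-m (gaps-multiplicity pos)
  with y , refl , y∈ , y-max ← conductor⇒maximum is-c x∈ = top-gap ks y∈ y-max

-- Recovering the coordinates from a gapset

initial-segment : ∀ {P : ℕ → Set} → Decidable P → (∀ {i j} → i ≤ j → P j → P i) →
  ∀ N → (∀ {j} → P j → j < N) → ∃ λ k → (∀ {j} → P j → j < k) × (∀ {j} → j < k → P j)
initial-segment P? down zero bound = 0 , bound , λ ()
initial-segment P? down (suc N) bound with P? N
... | yes p = suc N , bound , λ j<1+N → down (≤-pred j<1+N) p
... | no ¬p = initial-segment P? down N λ pj → ≤∧≢⇒< (≤-pred (bound pj)) λ { refl → ¬p pj }

sorted-ext : ∀ {xs ys : List ℕ} → AllPairs _<_ xs → AllPairs _<_ ys →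
  (∀ {z} → z ∈ xs → z ∈ ys) → (∀ {z} → z ∈ ys → z ∈ xs) → xs ≡ ys
sorted-ext {[]} {[]} _ _ _ _ = refl
sorted-ext {[]} {y ∷ ys} _ _ _ from = contradiction (from (here refl)) λ ()
sorted-ext {x ∷ xs} {[]} _ _ to _ = contradiction (to (here refl)) λ ()
sorted-ext {x ∷ xs} {y ∷ ys} (x< ∷ sx) (y< ∷ sy) to from =
  cong₂ _∷_ x≡y (sorted-ext sx sy
    (λ z∈ → tail (to (there z∈)) (<⇒≢ (All.lookup x< z∈) ∘ trans x≡y ∘ sym))
    (λ z∈ → tail (from (there z∈)) (<⇒≢ (All.lookup y< z∈) ∘ trans (sym x≡y) ∘ sym)))
  where
  least : ∀ {u z : ℕ} {us} → All (u <_) us → z ∈ u ∷ us → u ≤ z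
  least _ (here refl) = ≤-refl
  least u< (there z∈) = <⇒≤ (All.lookup u< z∈)
  x≡y : x ≡ y
  x≡y = ≤-antisym (least x< (from (here refl))) (least y< (to (here refl)))
  tail : ∀ {u z : ℕ} {us} → z ∈ u ∷ us → z ≢ u → z ∈ us
  tail (here eq) z≢u = contradiction eq z≢u
  tail (there z∈) _ = z∈

module _ {G n c} (gapset : IsGapset G) (is-m : IsMultiplicity G (suc n)) (is-c : IsConductor G c) where
  private
    m = suc n

    -- Split one m off the gap: m is not in G, so the other summand must be. The positivity
    -- assumption keeps every intermediate summand admissible, which matters for residue 0.
    down : ∀ {a i j} → 1 ≤ a + i * m → i ≤ j → a + j * m ∈ G → a + i * m ∈ G
    down {a} {i} {zero} _ z≤n p = p
    down {a} {i} {suc j} pos i≤j p with i ≟ suc j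
    ... | yes refl = p
    ... | no i≢j = down pos i≤j′ (drop (proj₂ (proj₂ gapset) _ p (a + j * m) m 1≤x (s≤s z≤n) (rearrange a m (j * m))))
      where
      i≤j′ : i ≤ j
      i≤j′ = ≤-pred (≤∧≢⇒< i≤j i≢j)
      1≤x = ≤-trans pos (+-monoʳ-≤ a (*-monoˡ-≤ m i≤j′))
      rearrange : ∀ a m x → a + (m + x) ≡ a + x + m
      rearrange = solve-∀
      drop : ∀ {x} → x ∈ G ⊎ m ∈ G → x ∈ G
      drop (inj₁ p) = p
      drop (inj₂ m∈) = contradiction m∈ (proj₁ (proj₂ is-m))

    column-height : ∀ i → ∃ λ k →
      (∀ {j} → suc i + j * m ∈ G → j < k) × (∀ {j} → j < k → suc i + j * m ∈ G)
    column-height i = initial-segment (λ j → ∈-dec _≟_ (suc i + j * m) G) (down (s≤s z≤n)) c bound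
      where
      -- Since m ≥ 1, the element is at least j, so j ≥ c would put a gap at or beyond the
      -- conductor.
      bound : ∀ {j} → suc i + j * m ∈ G → j < c
      bound {j} p = ≰⇒> λ c≤j → proj₁ is-c (suc i + j * m ∸ c) (subst (_∈ G) (sym (m+[n∸m]≡n (≤-trans c≤j j≤x))) p)
        where
        j≤x : j ≤ suc i + j * m
        j≤x = ≤-trans (m≤m*n j m) (m≤n+m (j * m) (suc i))

  coordinates : List ℕ
  coordinates = applyUpTo (λ i → proj₁ (column-height i)) n

  private
    same-m : m ≡ multiplicity coordinates
    same-m = cong suc (sym (length-applyUpTo (λ i → proj₁ (column-height i)) n))

    coordinate-height : ∀ {i} → i < n → coordinate coordinates (suc i) ≡ proj₁ (column-height i)
    coordinate-height = at-applyUpTo (λ i → proj₁ (column-height i))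

  coordinates-positive : Positive coordinates
  coordinates-positive = All.applyUpTo⁺₁ _ n λ {i} i<n → proj₁ (proj₂ (column-height i))
    (subst (_∈ G) (sym (+-identityʳ (suc i))) (proj₂ (proj₂ is-m) (suc i) (s≤s z≤n) (s≤s i<n)))

  gaps-coordinates : G ≡ gaps coordinates
  gaps-coordinates = sorted-ext
    (Linked⇒AllPairs <-trans (proj₁ (proj₂ gapset)))
    (Linked⇒AllPairs <-trans (gaps-sorted coordinates))
    (λ {z} → to (splitting n z))
    (λ {z} → from (subst (λ m → Split m z) (sym same-m) (splitting (length coordinates) z)))
    where
    to : ∀ {z} → Split m z → z ∈ G → z ∈ gaps coordinates
    to (split-at {zero} _ zero) z∈ = contradiction (All.lookup (proj₁ gapset) z∈) λ ()
    to (split-at {zero} _ (suc j)) z∈ = contradiction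
      (subst (_∈ G) (*-identityˡ m) (down {0} {1} {suc j} (s≤s z≤n) (s≤s z≤n) z∈)) (proj₁ (proj₂ is-m))
    to (split-at {suc i} (s≤s i<n) j) z∈ =
      subst (λ m → suc i + j * m ∈ gaps coordinates) (sym same-m) (∈-gaps⁺ coordinates (suc i)
        (subst (j <_) (sym (coordinate-height i<n)) (proj₁ (proj₂ (column-height i)) z∈)))
    from : ∀ {z} → Split m z → z ∈ gaps coordinates → z ∈ G
    from (split-at {zero} a<m j) z∈ =
      contradiction (∈-gaps⁻ coordinates (s≤s z≤n) j (subst (λ m → j * m ∈ gaps coordinates) same-m z∈)) λ ()
    from (split-at {suc i} a<m@(s≤s i<n) j) z∈ = proj₂ (proj₂ (column-height i))
      (subst (j <_) (coordinate-height i<n) (∈-gaps⁻ coordinates (subst (suc i <_) same-m a<m) j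
        (subst (λ m → suc i + j * m ∈ gaps coordinates) same-m z∈)))

-- Counting gapsets by their Kunz tuples

record KunzTuple (g q : ℕ) (ks : List ℕ) : Set where
  constructor kunzTuple
  field
    positive : Positive ks
    kunz     : Kunz ks
    total    : sum ks ≡ g
    top      : IsMaximum ks q

open KunzTuple

gapset⇒tuple : ∀ {g q G} → 1 ≤ g → IsGapset G → genus G ≡ g → HasDepth G q →
  ∃ λ ks → KunzTuple g q ks × G ≡ gaps ks
gapset⇒tuple {G = []} () _ refl _
gapset⇒tuple {G = G@(x ∷ _)} _ gapset refl depth@(suc n , c , is-m , is-c , _) =
  ks , kunzTuple pos (gapset⇒kunz (subst IsGapset G≡ gapset))
    (trans (sym (length-gaps ks)) (cong length (sym G≡)))
    (depth⇒maximum pos (subst (x ∈_) G≡ (here refl)) (subst (λ G → HasDepth G _) G≡ depth)) , G≡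
  where
  ks = coordinates gapset is-m is-c
  pos = coordinates-positive gapset is-m is-c
  G≡ = gaps-coordinates gapset is-m is-c

numGapsets : ∀ {g q n} → 1 ≤ g → Count (KunzTuple g q) n → NumGapsets g q n
numGapsets {g} {q} 1≤g C = elements D , unique D ,
  All.tabulate (λ G∈ → let ks , t , eq = sound D G∈ in
    subst (λ G → IsGapset G × genus G ≡ g × HasDepth G q) (sym eq)
      (kunz⇒gapset (kunz t) , trans (length-gaps ks) (total t) , maximum⇒depth (positive t) (top t))) ,
  (λ G gapset genus≡ depth → complete D (gapset⇒tuple 1≤g gapset genus≡ depth)) ,
  size D
  where
  D = count-map gaps (λ s t → gaps-injective (positive s) (positive t)) C

-- Depth bounds the multiplicity

at-++ˡ : ∀ xs ys {i} → i < length xs → at (xs ++ ys) i ≡ at xs i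
at-++ˡ (x ∷ xs) ys {zero} _ = refl
at-++ˡ (x ∷ xs) ys {suc i} (s≤s i<) = at-++ˡ xs ys i<

at-++ʳ : ∀ xs ys i → at (xs ++ ys) (length xs + i) ≡ at ys i
at-++ʳ [] ys i = refl
at-++ʳ (x ∷ xs) ys i = at-++ʳ xs ys i

at-≤ : ∀ {ks q} → All (_≤ q) ks → ∀ i → at ks i ≤ q
at-≤ [] i = z≤n
at-≤ (k≤q ∷ _) zero = k≤q
at-≤ (_ ∷ ks≤q) (suc i) = at-≤ ks≤q i

applyUpTo-at : ∀ ks → ks ≡ applyUpTo (at ks) (length ks)
applyUpTo-at ks = at-ext (sym (length-applyUpTo (at ks) (length ks))) λ i i< → sym (at-applyUpTo (at ks) i<)

-- The two end entries are mirror partners; removing both shifts f and lowers n by two. In odd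
-- length the middle entry is its own partner, which is why the sum is doubled. `applyUpTo` is used
-- because it can be shortened at either end.
mirror-bound-applyUpTo : ∀ t n f → (∀ i j → suc (i + j) ≡ n → t ≤ f i + f j) →
  n * t ≤ 2 * sum (applyUpTo f n)
mirror-bound-applyUpTo t zero f h = z≤n
mirror-bound-applyUpTo t (suc zero) f h =
  linear 2 (λ t x → t ≦ x ⊕ x ⇒ t ⊕ con 0 ≦ 2 ⊛ (x ⊕ con 0)) refl t (f 0) (h 0 0 refl)
mirror-bound-applyUpTo t (suc (suc n)) f h =
  linear 6 (λ t nt x y s s′ → t ≦ x ⊕ y ⇒ nt ≦ 2 ⊛ s′ ⇒ s ≐ s′ ⊕ (y ⊕ con 0) ⇒ t ⊕ (t ⊕ nt) ≦ 2 ⊛ (x ⊕ s)) refl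
    t (n * t) (f 0) (f (suc n)) (sum (applyUpTo (f ∘ suc) (suc n))) (sum (applyUpTo (f ∘ suc) n))
    (h 0 (suc n) refl)
    (mirror-bound-applyUpTo t n (f ∘ suc) λ i j eq → h (suc i) (suc j) (cong suc (trans (cong suc (+-suc i j)) (cong suc eq))))
    (trans (cong sum (sym (applyUpTo-∷ʳ (f ∘ suc) n))) (sum-++ (applyUpTo (f ∘ suc) n) (f (suc n) ∷ [])))

mirror-bound : ∀ t ks → (∀ i j → suc (i + j) ≡ length ks → t ≤ at ks i + at ks j) →
  length ks * t ≤ 2 * sum ks
mirror-bound t ks h = subst (λ ls → length ks * t ≤ 2 * sum ls) (sym (applyUpTo-at ks))
  (mirror-bound-applyUpTo t (length ks) (at ks) h)

-- Pair the residues a, b with a + b ≡ i, where i is the residue with kᵢ = q: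
-- those below i satisfy kₐ + k_b ≥ q, those above i satisfy kₐ + k_b ≥ q - 1.
genus-bound : ∀ {ks t} → Kunz ks → suc t ∈ ks → pred (length ks) * t + 2 * suc t ≤ 2 * sum ks
genus-bound {ks} {t} (K₁ , K₂) q∈ with ∈-∃++ q∈
... | xs , ys , refl = linear 7 (λ Q X Y L S pt rt →
      pt ≦ 2 ⊛ X ⇒ rt ≦ 2 ⊛ Y ⇒ S ≐ X ⊕ (Q ⊕ Y) ⇒ L ≐ pt ⊕ rt ⇒ L ⊕ 2 ⊛ Q ≦ 2 ⊛ S) refl
    (suc t) (sum xs) (sum ys) (pred (length (xs ++ suc t ∷ ys)) * t) (sum (xs ++ suc t ∷ ys)) (length xs * t) (length ys * t)
    (mirror-bound t xs below)
    (mirror-bound t ys above)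
    (sum-++ xs (suc t ∷ ys))
    (trans (cong (λ n → pred n * t) (trans len (+-suc (length xs) (length ys)))) (*-distribʳ-+ t (length xs) (length ys)))
  where
  q = suc t
  len : length (xs ++ q ∷ ys) ≡ length xs + suc (length ys)
  len = length-++ xs
  k = coordinate (xs ++ q ∷ ys)
  k-q : k (suc (length xs)) ≡ q
  k-q = trans (cong (at (xs ++ q ∷ ys)) (sym (+-identityʳ (length xs)))) (at-++ʳ xs (q ∷ ys) 0)
  k-ys : ∀ i → k (suc (length xs + suc i)) ≡ at ys i
  k-ys i = at-++ʳ xs (q ∷ ys) (suc i)
  below : ∀ i j → suc (i + j) ≡ length xs → t ≤ at xs i + at xs j
  below i j eq = <⇒≤ (subst₂ _≤_ (trans (cong k eq′) k-q)
      (cong₂ _+_ (at-++ˡ xs (q ∷ ys) i<) (at-++ˡ xs (q ∷ ys) j<))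
      (K₁ (suc i) (suc j) (s≤s (subst₂ _<_ (sym (suc-injective eq′)) (sym len) (m<m+n (length xs) (s≤s z≤n))))))
    where
    eq′ : suc i + suc j ≡ suc (length xs)
    eq′ = cong suc (trans (+-suc i j) eq)
    i< : i < length xs
    i< = subst (i <_) eq (s≤s (m≤m+n i j))
    j< : j < length xs
    j< = subst (j <_) eq (s≤s (m≤n+m j i))
  above : ∀ i j → suc (i + j) ≡ length ys → t ≤ at ys i + at ys j
  above i j eq = ≤-pred (subst₂ _≤_ k-q (cong suc (cong₂ _+_ (k-ys i) (k-ys j)))
      (K₂ (suc (length xs + suc i)) (suc (length xs + suc j)) (suc (length xs))
        (linear 5
          (λ x y i j l → con 1 ⊕ (i ⊕ j) ≐ y ⇒ l ≐ x ⊕ (con 1 ⊕ y) ⇒ con 1 ⊕ (x ⊕ (con 1 ⊕ i)) ≺ con 1 ⊕ l) refl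
          (length xs) (length ys) i j _ eq len)
        (linear 5
          (λ x y i j l → con 1 ⊕ (i ⊕ j) ≐ y ⇒ l ≐ x ⊕ (con 1 ⊕ y) ⇒ con 1 ⊕ (x ⊕ (con 1 ⊕ j)) ≺ con 1 ⊕ l) refl
          (length xs) (length ys) i j _ eq len)
        (linear 5 (λ x y i j l → con 1 ⊕ (i ⊕ j) ≐ y ⇒ l ≐ x ⊕ (con 1 ⊕ y) ⇒
          (con 1 ⊕ (x ⊕ (con 1 ⊕ i))) ⊕ (con 1 ⊕ (x ⊕ (con 1 ⊕ j))) ≐ (con 1 ⊕ l) ⊕ (con 1 ⊕ x)) refl (length xs) (length ys) i j _ eq len)))

-- With four or more coordinates, `genus-bound` gives 2g ≥ 3(q - 1) + 2q = 5q - 3, exactly what 5q ≥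
-- 2g + 4 excludes.
at-most-three : ∀ {g q ks} → 2 * g + 4 ≤ 5 * q → KunzTuple g q ks → length ks ≤ 3
at-most-three {g} {zero} h _ = contradiction (m+n≤o⇒n≤o (2 * g) h) λ ()
at-most-three {g} {suc t} {ks} h tuple = ≮⇒≥ λ 3<l → n≮0 (
  linear 3 (λ g t lt → 3 ⊛ t ≦ lt ⇒ lt ⊕ 2 ⊛ (con 1 ⊕ t) ≦ 2 ⊛ g ⇒ 2 ⊛ g ⊕ con 4 ≦ 5 ⊛ (con 1 ⊕ t) ⇒ falsum) refl
    g t (pred (length ks) * t)
    (*-monoˡ-≤ t (pred-mono-≤ 3<l))
    (subst (λ g → _ ≤ 2 * g) (total tuple) (genus-bound (kunz tuple) (proj₂ (top tuple))))
    h)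

-- Tuples with at most three coordinates

Pair : (g q a b : ℕ) → Set
Pair g q a b = (1 ≤ a × 1 ≤ b) × (b ≤ a + a × a ≤ 1 + (b + b)) × a + (b + 0) ≡ g ×
  (a ≤ q × b ≤ q) × (a ≡ q ⊎ b ≡ q)

-- The four inequalities come from 1 + 1 = 2, 1 + 2 = 3, 2 + 3 = 4 + 1 and 3 + 3 = 4 + 2. Every
-- other residue sum involves residue 0 or repeats one of these. The trailing `+ 0` is left by
-- unfolding `sum`.
Triple : (g q a b c : ℕ) → Set
Triple g q a b c = (1 ≤ a × 1 ≤ b × 1 ≤ c) ×
  (b ≤ a + a × c ≤ a + b × a ≤ 1 + (b + c) × b ≤ 1 + (c + c)) × a + (b + (c + 0)) ≡ g ×
  (a ≤ q × b ≤ q × c ≤ q) × (a ≡ q ⊎ b ≡ q ⊎ c ≡ q)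

-- Reified copies: ρ ⊨ pair … and ρ ⊨ triple … unfold to instances of Pair and Triple.
pair : ∀ {n} (g q a b : Expr n) → Formula n
pair g q a b = (con 1 ≦ a & con 1 ≦ b) & (b ≦ a ⊕ a & a ≦ con 1 ⊕ (b ⊕ b)) & a ⊕ (b ⊕ con 0) ≐ g &
  (a ≦ q & b ≦ q) & (a ≐ q ∣∣ b ≐ q)

triple : ∀ {n} (g q a b c : Expr n) → Formula n
triple g q a b c = (con 1 ≦ a & con 1 ≦ b & con 1 ≦ c) &
  (b ≦ a ⊕ a & c ≦ a ⊕ b & a ≦ con 1 ⊕ (b ⊕ c) & b ≦ con 1 ⊕ (c ⊕ c)) & a ⊕ (b ⊕ (c ⊕ con 0)) ≐ g &
  (a ≦ q & b ≦ q & c ≦ q) & (a ≐ q ∣∣ b ≐ q ∣∣ c ≐ q)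

tuple⇒pair : ∀ {g q a b} → KunzTuple g q (a ∷ b ∷ []) → Pair g q a b
tuple⇒pair {q = q} {a} {b} (kunzTuple (1≤a ∷ 1≤b ∷ []) (K₁ , K₂) sum≡ (a≤q ∷ b≤q ∷ [] , q∈)) =
  (1≤a , 1≤b) , (K₁ 1 1 (s≤s (s≤s (s≤s z≤n))) , K₂ 2 2 1 (s≤s (s≤s (s≤s z≤n))) (s≤s (s≤s (s≤s z≤n))) refl) ,
  sum≡ , (a≤q , b≤q) , member q∈
  where
  member : q ∈ a ∷ b ∷ [] → a ≡ q ⊎ b ≡ q
  member (here refl) = inj₁ refl
  member (there (here refl)) = inj₂ refl

pair⇒tuple : ∀ {g q a b} → Pair g q a b → KunzTuple g q (a ∷ b ∷ [])
pair⇒tuple {q = q} {a} {b} ((1≤a , 1≤b) , (b≤ , a≤) , sum≡ , (a≤q , b≤q) , max) =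
  kunzTuple (1≤a ∷ 1≤b ∷ []) (K₁ , K₂) sum≡ (a≤q ∷ b≤q ∷ [] , member max)
  where
  k = coordinate (a ∷ b ∷ [])
  K₁ : ∀ i j → i + j < 3 → k (i + j) ≤ k i + k j
  K₁ 0 j _ = ≤-refl
  K₁ 1 0 _ = m≤m+n a 0
  K₁ 1 1 _ = b≤
  K₁ 2 0 _ = m≤m+n b 0
  K₁ 1 (suc (suc j)) (s≤s (s≤s (s≤s ())))
  K₁ 2 (suc j) (s≤s (s≤s (s≤s ())))
  K₁ (suc (suc (suc i))) j (s≤s (s≤s (s≤s ())))
  K₂ : ∀ i j l → i < 3 → j < 3 → i + j ≡ 3 + l → k l ≤ suc (k i + k j)
  K₂ 1 2 l _ _ refl = z≤n
  K₂ 2 1 l _ _ refl = z≤n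
  K₂ 2 2 l _ _ refl = a≤
  K₂ 0 j l _ j<3 refl = contradiction j<3 (m+n≮m 3 l)
  K₂ 1 0 l _ _ ()
  K₂ 1 1 l _ _ ()
  K₂ 2 0 l _ _ ()
  K₂ (suc (suc (suc i))) j l (s≤s (s≤s (s≤s ())))
  K₂ 1 (suc (suc (suc j))) l _ (s≤s (s≤s (s≤s ())))
  K₂ 2 (suc (suc (suc j))) l _ (s≤s (s≤s (s≤s ())))
  member : a ≡ q ⊎ b ≡ q → q ∈ a ∷ b ∷ []
  member (inj₁ refl) = here refl
  member (inj₂ refl) = there (here refl)

tuple⇒triple : ∀ {g q a b c} → KunzTuple g q (a ∷ b ∷ c ∷ []) → Triple g q a b c
tuple⇒triple {q = q} {a} {b} {c} (kunzTuple (1≤a ∷ 1≤b ∷ 1≤c ∷ []) (K₁ , K₂) sum≡ (a≤q ∷ b≤q ∷ c≤q ∷ [] , q∈)) =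
  (1≤a , 1≤b , 1≤c) ,
  (K₁ 1 1 (s≤s (s≤s (s≤s z≤n))) , K₁ 1 2 3<4 , K₂ 2 3 1 (s≤s (s≤s (s≤s z≤n))) 3<4 refl , K₂ 3 3 2 3<4 3<4 refl) ,
  sum≡ , (a≤q , b≤q , c≤q) , member q∈
  where
  3<4 : 3 < 4
  3<4 = ≤-refl
  member : q ∈ a ∷ b ∷ c ∷ [] → a ≡ q ⊎ b ≡ q ⊎ c ≡ q
  member (here refl) = inj₁ refl
  member (there (here refl)) = inj₂ (inj₁ refl)
  member (there (there (here refl))) = inj₂ (inj₂ refl)

triple⇒tuple : ∀ {g q a b c} → Triple g q a b c → KunzTuple g q (a ∷ b ∷ c ∷ [])
triple⇒tuple {q = q} {a} {b} {c} ((1≤a , 1≤b , 1≤c) , (b≤ , c≤ , a≤ , b≤′) , sum≡ , (a≤q , b≤q , c≤q) , max) =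
  kunzTuple (1≤a ∷ 1≤b ∷ 1≤c ∷ []) (K₁ , K₂) sum≡ (a≤q ∷ b≤q ∷ c≤q ∷ [] , member max)
  where
  k = coordinate (a ∷ b ∷ c ∷ [])
  K₁ : ∀ i j → i + j < 4 → k (i + j) ≤ k i + k j
  K₁ 0 j _ = ≤-refl
  K₁ 1 0 _ = m≤m+n a 0
  K₁ 1 1 _ = b≤
  K₁ 1 2 _ = c≤
  K₁ 2 0 _ = m≤m+n b 0
  K₁ 2 1 _ = subst (c ≤_) (+-comm a b) c≤
  K₁ 3 0 _ = m≤m+n c 0
  K₁ 1 (suc (suc (suc j))) (s≤s (s≤s (s≤s (s≤s ()))))
  K₁ 2 (suc (suc j)) (s≤s (s≤s (s≤s (s≤s ()))))
  K₁ 3 (suc j) (s≤s (s≤s (s≤s (s≤s ()))))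
  K₁ (suc (suc (suc (suc i)))) j (s≤s (s≤s (s≤s (s≤s ()))))
  K₂ : ∀ i j l → i < 4 → j < 4 → i + j ≡ 4 + l → k l ≤ suc (k i + k j)
  K₂ 1 3 l _ _ refl = z≤n
  K₂ 2 2 l _ _ refl = z≤n
  K₂ 3 1 l _ _ refl = z≤n
  K₂ 2 3 l _ _ refl = a≤
  K₂ 3 2 l _ _ refl = subst (λ x → a ≤ suc x) (+-comm b c) a≤
  K₂ 3 3 l _ _ refl = b≤′
  K₂ 0 j l _ j<4 refl = contradiction j<4 (m+n≮m 4 l)
  K₂ 1 0 l _ _ ()
  K₂ 1 1 l _ _ ()
  K₂ 1 2 l _ _ ()
  K₂ 2 0 l _ _ ()
  K₂ 2 1 l _ _ ()
  K₂ 3 0 l _ _ ()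
  K₂ (suc (suc (suc (suc i)))) j l (s≤s (s≤s (s≤s (s≤s ()))))
  K₂ 1 (suc (suc (suc (suc j)))) l _ (s≤s (s≤s (s≤s (s≤s ()))))
  K₂ 2 (suc (suc (suc (suc j)))) l _ (s≤s (s≤s (s≤s (s≤s ()))))
  K₂ 3 (suc (suc (suc (suc j)))) l _ (s≤s (s≤s (s≤s (s≤s ()))))
  member : a ≡ q ⊎ b ≡ q ⊎ c ≡ q → q ∈ a ∷ b ∷ c ∷ []
  member (inj₁ refl) = here refl
  member (inj₂ (inj₁ refl)) = there (here refl)
  member (inj₂ (inj₂ refl)) = there (there (here refl))

Pairs Triples : ℕ → ℕ → List ℕ → Set
Pairs g q ks = ∃₂ λ a b → Pair g q a b × ks ≡ a ∷ b ∷ []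
Triples g q ks = ∃ λ a → ∃₂ λ b c → Triple g q a b c × ks ≡ a ∷ b ∷ c ∷ []

tuple⇒singleton : ∀ {g q a} → KunzTuple g q (a ∷ []) → a ≡ g × q ≡ g
tuple⇒singleton {a = a} tuple with total tuple | top tuple
... | refl | _ , here refl = sym (+-identityʳ a) , sym (+-identityʳ a)

classify : ∀ {g q} → 1 ≤ g → 2 * g + 4 ≤ 5 * q → ∀ {ks} → KunzTuple g q ks →
  (ks ≡ g ∷ [] × q ≡ g) ⊎ Pairs g q ks ⊎ Triples g q ks
classify 1≤g h {[]} tuple = contradiction (subst (1 ≤_) (sym (total tuple)) 1≤g) λ ()
classify 1≤g h {a ∷ []} tuple with tuple⇒singleton tuple
... | refl , q≡g = inj₁ (refl , q≡g)
classify 1≤g h {a ∷ b ∷ []} tuple = inj₂ (inj₁ (a , b , tuple⇒pair tuple , refl))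
classify 1≤g h {a ∷ b ∷ c ∷ []} tuple = inj₂ (inj₂ (a , b , c , tuple⇒triple tuple , refl))
classify 1≤g h {_ ∷ _ ∷ _ ∷ _ ∷ _} tuple with at-most-three h tuple
... | s≤s (s≤s (s≤s ()))

count-tuples : ∀ {g q m n} → 1 ≤ g → 2 * g + 4 ≤ 5 * q → q ≢ g →
  Count (Pairs g q) m → Count (Triples g q) n → Count (KunzTuple g q) (m + n)
count-tuples {g} {q} 1≤g h q≢g C D = count-cong
  [ (λ { (_ , _ , t , refl) → pair⇒tuple t }) , (λ { (_ , _ , _ , t , refl) → triple⇒tuple t }) ]′
  (λ t → [ (λ (_ , q≡g) → contradiction q≡g q≢g) , id ]′ (classify 1≤g h t))
  (count-⊎ (λ { (_ , _ , _ , refl) (_ , _ , _ , _ , ()) }) C D)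

-- The single tuple has multiplicity 2 and encodes the first g odd numbers. A further positive
-- coordinate would leave less than g for the maximum.
count-hyperelliptic : ∀ {g} → 2 ≤ g → Count (KunzTuple g g) 1
count-hyperelliptic {g} 2≤g = count-one (g ∷ [])
  (kunzTuple (1≤g ∷ []) (K₁ , K₂) (+-identityʳ g) (≤-refl ∷ [] , here refl))
  λ t → [ proj₁ , [ (λ (a , b , p , _) → contradiction (no-pair g a b 2≤g p) λ ())
                  , (λ (a , b , c , p , _) → contradiction (no-triple g a b c p) λ ()) ]′ ]′
    (classify 1≤g (linear 1 (λ g → con 2 ≦ g ⇒ 2 ⊛ g ⊕ con 4 ≦ 5 ⊛ g) refl g 2≤g) t)
  where
  1≤g = <⇒≤ 2≤g
  no-pair = linear 3 (λ g a b → con 2 ≦ g ⇒ pair g g a b ⇒ falsum) refl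
  no-triple = linear 4 (λ g a b c → triple g g a b c ⇒ falsum) refl
  k = coordinate (g ∷ [])
  K₁ : ∀ i j → i + j < 2 → k (i + j) ≤ k i + k j
  K₁ 0 j _ = ≤-refl
  K₁ 1 0 _ = m≤m+n g 0
  K₁ 1 (suc j) (s≤s (s≤s ()))
  K₁ (suc (suc i)) j (s≤s (s≤s ()))
  K₂ : ∀ i j l → i < 2 → j < 2 → i + j ≡ 2 + l → k l ≤ suc (k i + k j)
  K₂ 1 1 l _ _ refl = z≤n
  K₂ 0 j l _ j<2 refl = contradiction j<2 (m+n≮m 2 l)
  K₂ 1 0 l _ _ ()
  K₂ (suc (suc i)) j l (s≤s (s≤s ()))
  K₂ 1 (suc (suc j)) l _ (s≤s (s≤s ()))

-- The larger of two coordinates is at least g/2, and the inequalities b ≤ 2a and a ≤ 2b + 1 keep it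
-- at most (2g + 1)/3.
no-pairs : ∀ {g q} → 2 * q < g ⊎ 2 * g + 2 ≤ 3 * q → Count (Pairs g q) 0
no-pairs {g} {q} h = count-none λ (a , b , p , _) → n≮0
  (linear 4 (λ g q a b → (2 ⊛ q ≺ g ∣∣ 2 ⊛ g ⊕ con 2 ≦ 3 ⊛ q) ⇒ pair g q a b ⇒ falsum) refl g q a b h p)

one-pair : ∀ {g q a b} → Pair g q a b → (∀ {c d} → Pair g q c d → c ≡ a × d ≡ b) → Count (Pairs g q) 1
one-pair {a = a} {b} p only = count-one (a ∷ b ∷ []) (a , b , p , refl)
  λ { (_ , _ , p′ , refl) → let eq , eq′ = only p′ in cong₂ (λ a b → a ∷ b ∷ []) eq eq′ }

one-pair-equal : ∀ {q} → 1 ≤ q → Count (Pairs (2 * q) q) 1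
one-pair-equal {q} 1≤q = one-pair
  (linear 1 (λ q → con 1 ≦ q ⇒ (con 1 ≦ q & con 1 ≦ q) & (q ≦ q ⊕ q & q ≦ con 1 ⊕ (q ⊕ q)) &
    q ⊕ (q ⊕ con 0) ≐ 2 ⊛ q & (q ≦ q & q ≦ q) & (q ≐ q ∣∣ q ≐ q)) refl q 1≤q)
  (λ {c} {d} → linear 3 (λ q c d → pair (2 ⊛ q) q c d ⇒ c ≐ q & d ≐ q) refl q c d)

-- Only the first coordinate can be on top: it profits from the extra 1 in a ≤ 2b + 1, whereas b = q
-- would need 3q ≤ 2g.
one-pair-extremal : ∀ {g q} → 1 ≤ g → q < g → 3 * q ≡ 2 * g + 1 → Count (Pairs g q) 1
one-pair-extremal {g} {q} 1≤g q<g eq = one-pair {a = q} {g ∸ q}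
  (linear 3 (λ g q d → q ≺ g ⇒ 3 ⊛ q ≐ 2 ⊛ g ⊕ con 1 ⇒ d ⊕ q ≐ g ⇒ pair g q q d) refl g q (g ∸ q) q<g eq g∸q)
  (λ {c} {d} → linear 5 (λ g q c d e → 3 ⊛ q ≐ 2 ⊛ g ⊕ con 1 ⇒ e ⊕ q ≐ g ⇒ pair g q c d ⇒ c ≐ q & d ≐ e) refl
    g q c d (g ∸ q) eq g∸q)
  where g∸q = m∸n+n≡m (<⇒≤ q<g)

two-pairs : ∀ {g q} → g < 2 * q → 3 * q ≤ 2 * g → Count (Pairs g q) 2
two-pairs {g} {q} g<2q 3q≤2g = count-cong
  [ (λ { refl → q , e , linear 3 (λ g q e → g ≺ 2 ⊛ q ⇒ 3 ⊛ q ≦ 2 ⊛ g ⇒ e ⊕ q ≐ g ⇒ pair g q q e) refl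
    g q e g<2q 3q≤2g g∸q , refl })
  , (λ { refl → e , q , linear 3 (λ g q e → g ≺ 2 ⊛ q ⇒ 3 ⊛ q ≦ 2 ⊛ g ⇒ e ⊕ q ≐ g ⇒ pair g q e q) refl
    g q e g<2q 3q≤2g g∸q , refl }) ]′
  (λ { (a , b , p , refl) → [ (λ { (refl , refl) → inj₁ refl }) , (λ { (refl , refl) → inj₂ refl }) ]′
    (linear 5 (λ g q e a b → e ⊕ q ≐ g ⇒ pair g q a b ⇒ (a ≐ q & b ≐ e) ∣∣ (a ≐ e & b ≐ q)) refl
      g q e a b g∸q p) })
  (count-⊎ (λ { refl eq → <-irrefl refl (linear 3 (λ g q e → g ≺ 2 ⊛ q ⇒ e ⊕ q ≐ g ⇒ q ≐ e ⇒ q ≺ q) refl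
    g q e g<2q g∸q (∷-injectiveˡ eq)) })
    (count-one (q ∷ e ∷ []) refl id) (count-one (e ∷ q ∷ []) refl id))
  where
  e = g ∸ q
  q≤g : q ≤ g
  q≤g = linear 2 (λ g q → g ≺ 2 ⊛ q ⇒ 3 ⊛ q ≦ 2 ⊛ g ⇒ q ≦ g) refl g q g<2q 3q≤2g
  g∸q : e + q ≡ g
  g∸q = m∸n+n≡m q≤g

-- If a = q, then q ≤ 1 + (g - q). If c = q, then q ≤ g - q. If b = q, adding q ≤ 2a and q ≤ 1 + 2c
-- gives 4q ≤ 2g + 1. Each contradicts g + 2 ≤ 2q.
no-triples : ∀ {g q} → g + 2 ≤ 2 * q → Count (Triples g q) 0
no-triples {g} {q} h = count-none λ (a , b , c , p , _) → n≮0
  (linear 5 (λ g q a b c → g ⊕ con 2 ≦ 2 ⊛ q ⇒ triple g q a b c ⇒ falsum) refl g q a b c h p)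

-- Triples sorted by the position of the maximum

TriplesWith : (ℕ → ℕ → ℕ → Set) → ℕ → ℕ → List ℕ → Set
TriplesWith P g q ks = ∃ λ a → ∃₂ λ b c → (Triple g q a b c × P a b c) × ks ≡ a ∷ b ∷ c ∷ []

-- Ties go to the first coordinate, then to the last, so that the families are disjoint.
FirstTop LastTop MiddleTop : ℕ → ℕ → List ℕ → Set
FirstTop g q = TriplesWith (λ a b c → a ≡ q) g q
LastTop g q = TriplesWith (λ a b c → a < q × c ≡ q) g q
MiddleTop g q = TriplesWith (λ a b c → a < q × c < q) g q

count-triples : ∀ {g q k l m} → Count (FirstTop g q) k → Count (LastTop g q) l → Count (MiddleTop g q) m →
  Count (Triples g q) (k + (l + m))
count-triples {g} {q} C D E = count-cong
  [ forget , [ forget , forget ]′ ]′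
  (λ { (a , b , c , t , refl) →
    [ (λ h → inj₁ (a , b , c , (t , h) , refl))
    , [ (λ h → inj₂ (inj₁ (a , b , c , (t , h) , refl))) , (λ h → inj₂ (inj₂ (a , b , c , (t , h) , refl))) ]′ ]′
    (linear 5 (λ g q a b c → triple g q a b c ⇒ a ≐ q ∣∣ (a ≺ q & c ≐ q) ∣∣ (a ≺ q & c ≺ q)) refl
      g q a b c t) })
  (count-⊎ (λ { (_ , _ , _ , (_ , refl) , refl) (inj₁ (_ , _ , _ , (_ , a<q , _) , refl)) → <-irrefl refl a<q
              ; (_ , _ , _ , (_ , refl) , refl) (inj₂ (_ , _ , _ , (_ , a<q , _) , refl)) → <-irrefl refl a<q })
    C
    (count-⊎ (λ { (_ , _ , _ , (_ , _ , refl) , refl) (_ , _ , _ , (_ , _ , c<q) , refl) → <-irrefl refl c<q }) D E))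
  where
  forget : ∀ {P ks} → TriplesWith P g q ks → Triples g q ks
  forget (a , b , c , (t , _) , eq) = a , b , c , t , eq

module _ {q s : ℕ} (3q≥2s+4 : 2 * s + 4 ≤ 3 * q) where

  -- Here b + c = s. The lower end is the maximum of 1 and s - q, the latter from c ≤ q. The
  -- condition b ≤ 1 + 2c means 3b ≤ 2s + 1, so the excluded upper end lo + n is ⌊(2s + 1)/3⌋ + 1,
  -- pinned down by the last two inequalities.
  count-first-top : ∀ {lo n} → 2 ≤ s → q ≤ s + 1 → 1 ≤ lo → s ≤ q + lo → lo ≡ 1 ⊎ lo + q ≡ s →
    2 * s + 2 ≤ 3 * (lo + n) → 3 * (lo + n) ≤ 2 * s + 4 → Count (FirstTop (q + s) q) n
  count-first-top {lo} {n} 2≤s q≤s+1 1≤lo s≤ lo-min hi≥ hi≤ = count-cong to from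
    (count-map (λ b → q ∷ b ∷ s ∸ b ∷ []) (λ _ _ → ∷-injectiveˡ ∘ ∷-injectiveʳ) (count-interval lo n))
    where
    to : ∀ {ks} → (∃ λ b → (lo ≤ b × b < lo + n) × ks ≡ q ∷ b ∷ s ∸ b ∷ []) → FirstTop (q + s) q ks
    to (b , range@(lo≤b , b<) , refl) = q , b , s ∸ b ,
      (linear 6 (λ q s b c lo n → 2 ⊛ s ⊕ con 4 ≦ 3 ⊛ q ⇒ con 2 ≦ s ⇒ q ≦ s ⊕ con 1 ⇒ con 1 ≦ lo ⇒ s ≦ q ⊕ lo ⇒
          3 ⊛ (lo ⊕ n) ≦ 2 ⊛ s ⊕ con 4 ⇒ (lo ≦ b & b ≺ lo ⊕ n) ⇒ c ⊕ b ≐ s ⇒ triple (q ⊕ s) q q b c) refl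
        q s b (s ∸ b) lo n 3q≥2s+4 2≤s q≤s+1 1≤lo s≤ hi≤ range (m∸n+n≡m b≤s) , refl) , refl
      where
      b≤s = linear 4 (λ s b lo n → con 2 ≦ s ⇒ 3 ⊛ (lo ⊕ n) ≦ 2 ⊛ s ⊕ con 4 ⇒ b ≺ lo ⊕ n ⇒ b ≦ s) refl
        s b lo n 2≤s hi≤ b<
    from : ∀ {ks} → FirstTop (q + s) q ks → ∃ λ b → (lo ≤ b × b < lo + n) × ks ≡ q ∷ b ∷ s ∸ b ∷ []
    from (a , b , c , (t , refl) , refl) = b ,
      linear 6 (λ q s b c lo n → (lo ≐ con 1 ∣∣ lo ⊕ q ≐ s) ⇒ 2 ⊛ s ⊕ con 2 ≦ 3 ⊛ (lo ⊕ n) ⇒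
        triple (q ⊕ s) q q b c ⇒ lo ≦ b & b ≺ lo ⊕ n) refl q s b c lo n lo-min hi≥ t ,
      cong (λ c → q ∷ b ∷ c ∷ []) (trans (sym (m+n∸n≡m c b)) (cong (_∸ b)
        (linear 4 (λ q s b c → triple (q ⊕ s) q q b c ⇒ c ⊕ b ≐ s) refl q s b c t)))

  -- Here a + b = s. The strict bound a < q gives the lower end s - q + 1, and b ≤ 2a means 3b ≤ 2s,
  -- so the excluded upper end is ⌊2s/3⌋ + 1.
  count-last-top : ∀ {lo n} → q ≤ s → lo + q ≡ s + 1 →
    2 * s + 1 ≤ 3 * (lo + n) → 3 * (lo + n) ≤ 2 * s + 3 → Count (LastTop (q + s) q) n
  count-last-top {lo} {n} q≤s lo≡ hi≥ hi≤ = count-cong to from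
    (count-map (λ b → s ∸ b ∷ b ∷ q ∷ []) (λ _ _ → ∷-injectiveˡ ∘ ∷-injectiveʳ) (count-interval lo n))
    where
    to : ∀ {ks} → (∃ λ b → (lo ≤ b × b < lo + n) × ks ≡ s ∸ b ∷ b ∷ q ∷ []) → LastTop (q + s) q ks
    to (b , range@(lo≤b , b<) , refl) = s ∸ b , b , q ,
      (linear 6 (λ q s b a lo n → 2 ⊛ s ⊕ con 4 ≦ 3 ⊛ q ⇒ q ≦ s ⇒ lo ⊕ q ≐ s ⊕ con 1 ⇒
          3 ⊛ (lo ⊕ n) ≦ 2 ⊛ s ⊕ con 3 ⇒ (lo ≦ b & b ≺ lo ⊕ n) ⇒ a ⊕ b ≐ s ⇒
          triple (q ⊕ s) q a b q & a ≺ q & q ≐ q) refl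
        q s b (s ∸ b) lo n 3q≥2s+4 q≤s lo≡ hi≤ range (m∸n+n≡m b≤s)) , refl
      where
      b≤s = linear 4 (λ s b lo n → 3 ⊛ (lo ⊕ n) ≦ 2 ⊛ s ⊕ con 3 ⇒ b ≺ lo ⊕ n ⇒ b ≦ s) refl s b lo n hi≤ b<
    from : ∀ {ks} → LastTop (q + s) q ks → ∃ λ b → (lo ≤ b × b < lo + n) × ks ≡ s ∸ b ∷ b ∷ q ∷ []
    from (a , b , c , (t , a<q , refl) , refl) = b ,
      linear 6 (λ q s a b lo n → lo ⊕ q ≐ s ⊕ con 1 ⇒ 2 ⊛ s ⊕ con 1 ≦ 3 ⊛ (lo ⊕ n) ⇒
        triple (q ⊕ s) q a b q ⇒ a ≺ q ⇒ lo ≦ b & b ≺ lo ⊕ n) refl q s a b lo n lo≡ hi≥ t a<q ,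
      cong (λ a → a ∷ b ∷ q ∷ []) (trans (sym (m+n∸n≡m a b)) (cong (_∸ b)
        (linear 4 (λ q s a b → triple (q ⊕ s) q a b q ⇒ a ⊕ b ≐ s) refl q s a b t)))

  -- Here a + c = s. From q ≤ 2a and q ≤ 1 + 2c one gets ⌈q/2⌉ ≤ a ≤ s - ⌊q/2⌋. The two halves add
  -- up to q, so the number of values is s - q + 1 for either parity.
  count-middle-top : ∀ {n} → n + q ≡ s + 1 → Count (MiddleTop (q + s) q) n
  count-middle-top {n} n≡ = count-cong to from
    (count-map (λ a → a ∷ q ∷ s ∸ a ∷ []) (λ _ _ → ∷-injectiveˡ) (count-interval lo n))
    where
    lo = ⌈ q /2⌉
    lo-half : q ≤ lo + lo × lo + lo ≤ q + 1
    lo-half = linear 3 (λ q u v → u ⊕ v ≐ q ⇒ u ≦ v ⇒ v ≦ con 1 ⊕ u ⇒ q ≦ v ⊕ v & v ⊕ v ≦ q ⊕ con 1) refl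
      -- The last argument is ⌈q/2⌉ ≤ 1 + ⌊q/2⌋, because `⌈ q /2⌉` unfolds to ⌊(q + 1)/2⌋ and ⌊(q +
      -- 2)/2⌋ to 1 + ⌊q/2⌋.
      q ⌊ q /2⌋ ⌈ q /2⌉ (⌊n/2⌋+⌈n/2⌉≡n q) (⌊n/2⌋≤⌈n/2⌉ q) (⌊n/2⌋-mono (n≤1+n (suc q)))
    to : ∀ {ks} → (∃ λ a → (lo ≤ a × a < lo + n) × ks ≡ a ∷ q ∷ s ∸ a ∷ []) → MiddleTop (q + s) q ks
    to (a , range@(lo≤a , a<) , refl) = a , q , s ∸ a ,
      (linear 6 (λ q s a c lo n → 2 ⊛ s ⊕ con 4 ≦ 3 ⊛ q ⇒ n ⊕ q ≐ s ⊕ con 1 ⇒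
          (q ≦ lo ⊕ lo & lo ⊕ lo ≦ q ⊕ con 1) ⇒ (lo ≦ a & a ≺ lo ⊕ n) ⇒ c ⊕ a ≐ s ⇒
          triple (q ⊕ s) q a q c & a ≺ q & c ≺ q) refl
        q s a (s ∸ a) lo n 3q≥2s+4 n≡ lo-half range (m∸n+n≡m a≤s)) , refl
      where
      a≤s = linear 5 (λ q s a lo n → n ⊕ q ≐ s ⊕ con 1 ⇒ lo ⊕ lo ≦ q ⊕ con 1 ⇒ 2 ⊛ s ⊕ con 4 ≦ 3 ⊛ q ⇒ a ≺ lo ⊕ n ⇒ a ≦ s) refl
        q s a lo n n≡ (proj₂ lo-half) 3q≥2s+4 a<
    from : ∀ {ks} → MiddleTop (q + s) q ks → ∃ λ a → (lo ≤ a × a < lo + n) × ks ≡ a ∷ q ∷ s ∸ a ∷ []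
    from (a , b , c , (t , a<q , c<q) , refl)
      with linear 5 (λ q s a b c → triple (q ⊕ s) q a b c ⇒ a ≺ q ⇒ c ≺ q ⇒ b ≐ q) refl q s a b c t a<q c<q
    ... | refl = a ,
      linear 6 (λ q s a c lo n → n ⊕ q ≐ s ⊕ con 1 ⇒ (q ≦ lo ⊕ lo & lo ⊕ lo ≦ q ⊕ con 1) ⇒
        triple (q ⊕ s) q a q c ⇒ lo ≦ a & a ≺ lo ⊕ n) refl q s a c lo n n≡ lo-half t ,
      cong (λ c → a ∷ q ∷ c ∷ []) (trans (sym (m+n∸n≡m c a)) (cong (_∸ a)
        (linear 4 (λ q s a c → triple (q ⊕ s) q a q c ⇒ c ⊕ a ≐ s) refl q s a c t)))

-- Sizes of the families

division-by-3 : ∀ x → x ≡ x % 3 + 3 * (x / 3)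
division-by-3 x = trans (m≡m%n+[m/n]*n x 3) (cong (x % 3 +_) (*-comm (x / 3) 3))

-- Turns the floor in the stated counts into two linear inequalities, with 2 moved across to avoid
-- subtraction.
[x/3]+2 : ∀ x n → 3 * n ≤ x + 6 → x + 6 < 3 * n + 3 → n ≡ x / 3 + 2
[x/3]+2 x n lower upper = linear 4 (λ x r d n → x ≐ r ⊕ 3 ⊛ d ⇒ r ≺ con 3 ⇒ 3 ⊛ n ≦ x ⊕ con 6 ⇒
  x ⊕ con 6 ≺ 3 ⊛ n ⊕ con 3 ⇒ n ≐ d ⊕ con 2) refl x (x % 3) (x / 3) n (division-by-3 x) (m%n<n x 3) lower upper

-- e = ⌊t/3⌋ and e + u = ⌊(t + 1)/3⌋
Thirds : ℕ → ℕ → ℕ → Set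
Thirds t e u = (u ≡ 0 × 3 * e ≤ t × t ≤ 3 * e + 1) ⊎ (u ≡ 1 × t ≡ 3 * e + 2)

thirds-of : ∀ {n} (t e u : Expr n) → Formula n
thirds-of t e u = (u ≐ con 0 & 3 ⊛ e ≦ t & t ≦ 3 ⊛ e ⊕ con 1) ∣∣ (u ≐ con 1 & t ≐ 3 ⊛ e ⊕ con 2)

thirds : ∀ t → ∃₂ (Thirds t)
thirds t with t % 3 | m%n<n t 3 | division-by-3 t
... | 0 | _ | eq = t / 3 , 0 , inj₁ (refl , linear 2 (λ t e → t ≐ 3 ⊛ e ⇒ 3 ⊛ e ≦ t & t ≦ 3 ⊛ e ⊕ con 1) refl
  t (t / 3) eq)
... | 1 | _ | eq = t / 3 , 0 , inj₁ (refl , linear 2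
  (λ t e → t ≐ con 1 ⊕ 3 ⊛ e ⇒ 3 ⊛ e ≦ t & t ≦ 3 ⊛ e ⊕ con 1) refl
  t (t / 3) eq)
... | 2 | _ | eq = t / 3 , 1 , inj₂ (refl , trans eq (+-comm 2 (3 * (t / 3))))
... | suc (suc (suc _)) | s≤s (s≤s (s≤s ())) | _

-- With d = s - q, the families have sizes e + u + 1 - d, e - d and d + 1. Since ⌊2s/3⌋ + ⌊(2s +
-- 1)/3⌋ = s + ⌊s/3⌋, they add up to q + ⌊s/3⌋ + 2, and g + 2q = 3q + s.
count-below-half : ∀ {q s} → q < s → 2 * s + 4 < 3 * q → Count (KunzTuple (q + s) q) ((q + s + 2 * q) / 3 + 2)
count-below-half {q} {s} q<s h with thirds (2 * s)
... | e , u , th = subst (Count (KunzTuple (q + s) q)) count-size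
  (count-tuples (≤-trans (m<n⇒0<n q<s) (m≤n+m s q))
    (linear 2 (λ q s → 2 ⊛ s ⊕ con 4 ≺ 3 ⊛ q ⇒ 2 ⊛ (q ⊕ s) ⊕ con 4 ≦ 5 ⊛ q) refl q s h)
    (<⇒≢ (m<m+n q (m<n⇒0<n q<s)))
    (no-pairs (inj₁ (linear 2 (λ q s → q ≺ s ⇒ 2 ⊛ q ≺ q ⊕ s) refl q s q<s)))
    (count-triples
      (count-first-top (<⇒≤ h) {d} {k} (2≤s) (linear 2 (λ q s → q ≺ s ⇒ q ≦ s ⊕ con 1) refl q s q<s)
        (linear 3 (λ q s d → q ≺ s ⇒ d ⊕ q ≐ s ⇒ con 1 ≦ d) refl q s d q<s d≡)
        (≤-reflexive (trans (sym d≡) (+-comm d q)))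
        (inj₂ d≡)
        (linear 5
          (λ s d k e u → thirds-of (2 ⊛ s) e u ⇒ k ⊕ d ≐ con 1 ⊕ e ⊕ u ⇒ 2 ⊛ s ⊕ con 2 ≦ 3 ⊛ (d ⊕ k)) refl
          s d k e u th k≡)
        (linear 5
          (λ s d k e u → thirds-of (2 ⊛ s) e u ⇒ k ⊕ d ≐ con 1 ⊕ e ⊕ u ⇒ 3 ⊛ (d ⊕ k) ≦ 2 ⊛ s ⊕ con 4) refl
          s d k e u th k≡))
      (count-last-top (<⇒≤ h) {suc d} {l} (<⇒≤ q<s)
        (trans (cong suc d≡) (+-comm 1 s))
        (linear 5 (λ s d l e u → thirds-of (2 ⊛ s) e u ⇒ l ⊕ d ≐ e ⇒ 2 ⊛ s ⊕ con 1 ≦ 3 ⊛ (con 1 ⊕ d ⊕ l)) refl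
          s d l e u th l≡)
        (linear 5 (λ s d l e u → thirds-of (2 ⊛ s) e u ⇒ l ⊕ d ≐ e ⇒ 3 ⊛ (con 1 ⊕ d ⊕ l) ≦ 2 ⊛ s ⊕ con 3) refl
          s d l e u th l≡))
      (count-middle-top (<⇒≤ h) {suc d} (trans (cong suc d≡) (+-comm 1 s)))))
  where
  2≤s : 2 ≤ s
  2≤s = linear 2 (λ q s → 2 ⊛ s ⊕ con 4 ≺ 3 ⊛ q ⇒ q ≺ s ⇒ con 2 ≦ s) refl q s h q<s
  d = s ∸ q
  k = (suc e + u) ∸ d
  l = e ∸ d
  d≡ : d + q ≡ s
  d≡ = m∸n+n≡m (<⇒≤ q<s)
  d≤e : d ≤ e
  d≤e = linear 5 (λ q s d e u → thirds-of (2 ⊛ s) e u ⇒ 2 ⊛ s ⊕ con 4 ≺ 3 ⊛ q ⇒ d ⊕ q ≐ s ⇒ d ≦ e) refl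
    q s d e u th h d≡
  k≡ : k + d ≡ suc e + u
  k≡ = m∸n+n≡m (≤-trans d≤e (≤-trans (n≤1+n e) (m≤m+n (suc e) u)))
  l≡ : l + d ≡ e
  l≡ = m∸n+n≡m d≤e
  count-size : 0 + (k + (l + suc d)) ≡ (q + s + 2 * q) / 3 + 2
  count-size = [x/3]+2 (q + s + 2 * q) _
    (linear 7 (λ q s d k l e u → thirds-of (2 ⊛ s) e u ⇒ d ⊕ q ≐ s ⇒ k ⊕ d ≐ con 1 ⊕ e ⊕ u ⇒ l ⊕ d ≐ e ⇒
      3 ⊛ (k ⊕ (l ⊕ (con 1 ⊕ d))) ≦ q ⊕ s ⊕ 2 ⊛ q ⊕ con 6) refl q s d k l e u th d≡ k≡ l≡)
    (linear 7 (λ q s d k l e u → thirds-of (2 ⊛ s) e u ⇒ d ⊕ q ≐ s ⇒ k ⊕ d ≐ con 1 ⊕ e ⊕ u ⇒ l ⊕ d ≐ e ⇒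
      q ⊕ s ⊕ 2 ⊛ q ⊕ con 6 ≺ 3 ⊛ (k ⊕ (l ⊕ (con 1 ⊕ d))) ⊕ con 3) refl q s d k l e u th d≡ k≡ l≡)

-- The formula for smaller depths persists. At s = q the first family would start at b = 0; this
-- degenerate triple is lost, and the pair (q, q) makes up for it.
count-at-half : ∀ {q} → 4 ≤ q → Count (KunzTuple (2 * q) q) ((2 * (2 * q)) / 3 + 2)
count-at-half {q} 4≤q with thirds (2 * q)
... | e , u , th = subst (Count (KunzTuple (2 * q) q)) count-size
  (count-tuples (linear 1 (λ q → con 4 ≦ q ⇒ con 1 ≦ 2 ⊛ q) refl q 4≤q)
    (linear 1 (λ q → con 4 ≦ q ⇒ 2 ⊛ (2 ⊛ q) ⊕ con 4 ≦ 5 ⊛ q) refl q 4≤q)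
    (<⇒≢ (linear 1 (λ q → con 4 ≦ q ⇒ q ≺ 2 ⊛ q) refl q 4≤q))
    (one-pair-equal (≤-trans (s≤s z≤n) 4≤q))
    (count-triples
      (count-first-top h {1} {e + u}
        (linear 1 (λ q → con 4 ≦ q ⇒ con 2 ≦ q ⊕ con 0) refl q 4≤q)
        (linear 1 (λ q → q ≦ q ⊕ con 0 ⊕ con 1) refl q)
        ≤-refl
        (linear 1 (λ q → q ⊕ con 0 ≦ q ⊕ con 1) refl q)
        (inj₁ refl)
        (linear 3 (λ q e u → thirds-of (2 ⊛ q) e u ⇒ 2 ⊛ (q ⊕ con 0) ⊕ con 2 ≦ 3 ⊛ (con 1 ⊕ (e ⊕ u))) refl
          q e u th)
        (linear 3 (λ q e u → thirds-of (2 ⊛ q) e u ⇒ 3 ⊛ (con 1 ⊕ (e ⊕ u)) ≦ 2 ⊛ (q ⊕ con 0) ⊕ con 4) refl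
          q e u th))
      (count-last-top h {1} {e}
        (linear 1 (λ q → q ≦ q ⊕ con 0) refl q)
        (linear 1 (λ q → con 1 ⊕ q ≐ q ⊕ con 0 ⊕ con 1) refl q)
        (linear 3 (λ q e u → thirds-of (2 ⊛ q) e u ⇒ 2 ⊛ (q ⊕ con 0) ⊕ con 1 ≦ 3 ⊛ (con 1 ⊕ e)) refl q e u th)
        (linear 3 (λ q e u → thirds-of (2 ⊛ q) e u ⇒ 3 ⊛ (con 1 ⊕ e) ≦ 2 ⊛ (q ⊕ con 0) ⊕ con 3) refl
          q e u th))
      (count-middle-top h {1} (linear 1 (λ q → con 1 ⊕ q ≐ q ⊕ con 0 ⊕ con 1) refl q))))
  where
  -- `2 * q` unfolds to `q + (q + 0)`, so `q + 0` takes the place of s. The inequality amounts to 4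
  -- ≤ q.
  h : 2 * (q + 0) + 4 ≤ 3 * q
  h = linear 1 (λ q → con 4 ≦ q ⇒ 2 ⊛ (q ⊕ con 0) ⊕ con 4 ≦ 3 ⊛ q) refl q 4≤q
  count-size : 1 + (e + u + (e + 1)) ≡ (2 * (2 * q)) / 3 + 2
  count-size = [x/3]+2 (2 * (2 * q)) _
    (linear 3
      (λ q e u → thirds-of (2 ⊛ q) e u ⇒ 3 ⊛ (con 1 ⊕ (e ⊕ u ⊕ (e ⊕ con 1))) ≦ 2 ⊛ (2 ⊛ q) ⊕ con 6) refl
      q e u th)
    (linear 3
      (λ q e u → thirds-of (2 ⊛ q) e u ⇒ 2 ⊛ (2 ⊛ q) ⊕ con 6 ≺ 3 ⊛ (con 1 ⊕ (e ⊕ u ⊕ (e ⊕ con 1))) ⊕ con 3) refl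
      q e u th)

-- With q = s + 1, a last coordinate on top violates c ≤ a + b = s, and a middle one would need 2q ≤
-- 2s + 1. The first family keeps ⌊(2s + 1)/3⌋ = ⌊g/3⌋ members, and the two pairs give the summand
-- 2.
count-above-half : ∀ {s} → 2 ≤ s → Count (KunzTuple (s + 1 + s) (s + 1)) ((s + 1 + s) / 3 + 2)
count-above-half {s} 2≤s with thirds (2 * s)
... | e , u , th = subst (Count (KunzTuple (s + 1 + s) (s + 1))) count-size
  (count-tuples (linear 1 (λ s → con 1 ≦ s ⊕ con 1 ⊕ s) refl s)
    (linear 1 (λ s → con 2 ≦ s ⇒ 2 ⊛ (s ⊕ con 1 ⊕ s) ⊕ con 4 ≦ 5 ⊛ (s ⊕ con 1)) refl s 2≤s)
    (<⇒≢ (linear 1 (λ s → con 2 ≦ s ⇒ s ⊕ con 1 ≺ s ⊕ con 1 ⊕ s) refl s 2≤s))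
    (two-pairs (linear 1 (λ s → s ⊕ con 1 ⊕ s ≺ 2 ⊛ (s ⊕ con 1)) refl s)
      (linear 1 (λ s → con 2 ≦ s ⇒ 3 ⊛ (s ⊕ con 1) ≦ 2 ⊛ (s ⊕ con 1 ⊕ s)) refl s 2≤s))
    (count-triples
      (count-first-top (linear 1 (λ s → con 2 ≦ s ⇒ 2 ⊛ s ⊕ con 4 ≦ 3 ⊛ (s ⊕ con 1)) refl
        s 2≤s) {1} {e + u} 2≤s ≤-refl ≤-refl
        (linear 1 (λ s → s ≦ s ⊕ con 1 ⊕ con 1) refl s)
        (inj₁ refl)
        (linear 3 (λ s e u → thirds-of (2 ⊛ s) e u ⇒ 2 ⊛ s ⊕ con 2 ≦ 3 ⊛ (con 1 ⊕ (e ⊕ u))) refl s e u th)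
        (linear 3 (λ s e u → thirds-of (2 ⊛ s) e u ⇒ 3 ⊛ (con 1 ⊕ (e ⊕ u)) ≦ 2 ⊛ s ⊕ con 4) refl s e u th))
      (count-none λ (a , b , c , (t , a<q , c≡q) , _) → n≮0
        (linear 4
          (λ s a b c → triple (s ⊕ con 1 ⊕ s) (s ⊕ con 1) a b c ⇒ a ≺ s ⊕ con 1 ⇒ c ≐ s ⊕ con 1 ⇒ falsum) refl
          s a b c t a<q c≡q))
      (count-none λ (a , b , c , (t , a<q , c<q) , _) → n≮0
        (linear 4
          (λ s a b c → triple (s ⊕ con 1 ⊕ s) (s ⊕ con 1) a b c ⇒ a ≺ s ⊕ con 1 ⇒ c ≺ s ⊕ con 1 ⇒ falsum) refl
          s a b c t a<q c<q))))
  where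
  count-size : 2 + (e + u + 0) ≡ (s + 1 + s) / 3 + 2
  count-size = [x/3]+2 (s + 1 + s) _
    (linear 3 (λ s e u → thirds-of (2 ⊛ s) e u ⇒ 3 ⊛ (con 2 ⊕ (e ⊕ u ⊕ con 0)) ≦ s ⊕ con 1 ⊕ s ⊕ con 6) refl
      s e u th)
    (linear 3
      (λ s e u → thirds-of (2 ⊛ s) e u ⇒ s ⊕ con 1 ⊕ s ⊕ con 6 ≺ 3 ⊛ (con 2 ⊕ (e ⊕ u ⊕ con 0)) ⊕ con 3) refl
      s e u th)

-- Depths one and two

small-coordinates-kunz : ∀ {ks} → Positive ks → All (_≤ 2) ks → Kunz ks
small-coordinates-kunz {ks} pos ≤2 = K₁ , K₂
  where
  m = multiplicity ks
  k = coordinate ks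
  k≤2 : ∀ i → k i ≤ 2
  k≤2 = at-≤ (z≤n ∷ ≤2)
  K₁ : ∀ i j → i + j < m → k (i + j) ≤ k i + k j
  K₁ zero j _ = ≤-refl
  K₁ i@(suc _) zero _ = ≤-trans (≤-reflexive (cong k (+-identityʳ i))) (m≤m+n (k i) 0)
  K₁ i@(suc _) j@(suc _) i+j<m = ≤-trans (k≤2 (i + j)) (+-mono-≤
    (coordinate-positive pos (s≤s z≤n) (≤-<-trans (m≤m+n i j) i+j<m))
    (coordinate-positive pos (s≤s z≤n) (≤-<-trans (m≤n+m j i) i+j<m)))
  K₂ : ∀ i j l → i < m → j < m → i + j ≡ m + l → k l ≤ suc (k i + k j)
  K₂ zero j l _ j<m refl = contradiction j<m (m+n≮m m l)
  K₂ i@(suc _) j l i<m _ _ = ≤-trans (k≤2 l) (s≤s (≤-trans (coordinate-positive pos (s≤s z≤n) i<m) (m≤m+n (k i) (k j))))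

sum-replicate-1 : ∀ n → sum (replicate n 1) ≡ n
sum-replicate-1 zero = refl
sum-replicate-1 (suc n) = cong suc (sum-replicate-1 n)

only-ones : ∀ {ks} → Positive ks → All (_≤ 1) ks → ks ≡ replicate (sum ks) 1
only-ones [] [] = refl
only-ones (s≤s z≤n ∷ pos) (s≤s z≤n ∷ ≤1) = cong (1 ∷_) (only-ones pos ≤1)

count-depth-1 : ∀ {g} → 1 ≤ g → Count (KunzTuple g 1) 1
count-depth-1 {g@(suc n)} _ = count-one (replicate g 1)
  (kunzTuple pos (small-coordinates-kunz pos (All.replicate⁺ g (s≤s z≤n))) (sum-replicate-1 g) (All.replicate⁺ g ≤-refl , here refl))
  λ t → trans (only-ones (positive t) (proj₁ (top t))) (cong (λ n → replicate n 1) (total t))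
  where
  pos : Positive (replicate g 1)
  pos = All.replicate⁺ g ≤-refl

Composition CompositionWith2 : ℕ → List ℕ → Set
Composition g ks = (Positive ks × All (_≤ 2) ks) × sum ks ≡ g
CompositionWith2 g ks = Composition g ks × 2 ∈ ks

composition-1∷ : ∀ {g ks} → Composition g ks → Composition (suc g) (1 ∷ ks)
composition-1∷ ((pos , ≤2) , refl) = (s≤s z≤n ∷ pos , s≤s z≤n ∷ ≤2) , refl

composition-2∷ : ∀ {g ks} → Composition g ks → Composition (2 + g) (2 ∷ ks)
composition-2∷ ((pos , ≤2) , refl) = (s≤s z≤n ∷ pos , ≤-refl ∷ ≤2) , refl

data First (g : ℕ) : List ℕ → Set where
  first-1 : ∀ {ks} → Composition (suc g) ks → First g (1 ∷ ks)
  first-2 : ∀ {ks} → Composition g ks → First g (2 ∷ ks)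

first : ∀ {g ks} → Composition (2 + g) ks → First g ks
first {ks = []} (_ , ())
first {ks = 1 ∷ ks} ((_ ∷ pos , _ ∷ ≤2) , eq) = first-1 ((pos , ≤2) , suc-injective eq)
first {ks = 2 ∷ ks} ((_ ∷ pos , _ ∷ ≤2) , eq) = first-2 ((pos , ≤2) , suc-injective (suc-injective eq))
first {ks = 0 ∷ ks} ((() ∷ _ , _) , _)
first {ks = suc (suc (suc _)) ∷ ks} ((_ , s≤s (s≤s ()) ∷ _) , _)

1∷≢2∷ : ∀ {P Q : List ℕ → Set} {ks} → (∃ λ ls → P ls × ks ≡ 1 ∷ ls) → ¬ (∃ λ ls → Q ls × ks ≡ 2 ∷ ls)
1∷≢2∷ (_ , _ , refl) (_ , _ , ())

count-compositions : ∀ g → Count (Composition g) (fib (suc g))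
count-compositions 0 = count-one [] (([] , []) , refl) only
  where
  only : ∀ {ks} → Composition 0 ks → ks ≡ []
  only {[]} _ = refl
  only {suc _ ∷ _} (_ , ())
  only {0 ∷ _} ((() ∷ _ , _) , _)
count-compositions 1 = count-one (1 ∷ []) (composition-1∷ (([] , []) , refl)) only
  where
  only : ∀ {ks} → Composition 1 ks → ks ≡ 1 ∷ []
  only {1 ∷ []} _ = refl
  only {[]} (_ , ())
  only {0 ∷ _} ((() ∷ _ , _) , _)
  only {1 ∷ suc _ ∷ _} (_ , ())
  only {1 ∷ 0 ∷ _} ((_ ∷ () ∷ _ , _) , _)
  only {suc (suc _) ∷ _} (_ , ())
count-compositions (suc (suc g)) = count-cong
  [ (λ { (_ , c , refl) → composition-1∷ c }) , (λ { (_ , c , refl) → composition-2∷ c }) ]′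
  (decompose ∘ first)
  (count-⊎ 1∷≢2∷
    (count-map (1 ∷_) (λ _ _ → ∷-injectiveʳ) (count-compositions (suc g)))
    (count-map (2 ∷_) (λ _ _ → ∷-injectiveʳ) (count-compositions g)))
  where
  decompose : ∀ {ks} → First g ks → (∃ λ ls → Composition (suc g) ls × ks ≡ 1 ∷ ls) ⊎ (∃ λ ls → Composition g ls × ks ≡ 2 ∷ ls)
  decompose (first-1 c) = inj₁ (_ , c , refl)
  decompose (first-2 c) = inj₂ (_ , c , refl)

∈⇒≤sum : ∀ {k ks} → k ∈ ks → k ≤ sum ks
∈⇒≤sum (here refl) = m≤m+n _ _
∈⇒≤sum {ks = l ∷ _} (there k∈) = ≤-trans (∈⇒≤sum k∈) (m≤n+m _ l)

-- After a leading 1 the rest must still contain a 2; after a leading 2 the rest is arbitrary. The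
-- form `suc n ≡ fib (suc g)` accounts for the all-ones composition and keeps subtraction out of the
-- induction.
count-compositions-with-2 : ∀ g → ∃ λ n → suc n ≡ fib (suc g) × Count (CompositionWith2 g) n
count-compositions-with-2 0 = 0 , refl , count-none λ ((_ , eq) , 2∈) → n≮0 (subst (2 ≤_) eq (∈⇒≤sum 2∈))
count-compositions-with-2 1 = 0 , refl , count-none λ ((_ , eq) , 2∈) → n≮0 (≤-pred (subst (2 ≤_) eq (∈⇒≤sum 2∈)))
count-compositions-with-2 (suc (suc g)) with count-compositions-with-2 (suc g)
... | n , eq , C = n + fib (suc g) , cong (_+ fib (suc g)) eq , count-cong
  [ (λ { (_ , (c , 2∈) , refl) → composition-1∷ c , there 2∈ }) , (λ { (_ , c , refl) → composition-2∷ c , here refl }) ]′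
  (λ (c , 2∈) → decompose (first c) 2∈)
  (count-⊎ 1∷≢2∷
    (count-map (1 ∷_) (λ _ _ → ∷-injectiveʳ) C)
    (count-map (2 ∷_) (λ _ _ → ∷-injectiveʳ) (count-compositions g)))
  where
  decompose : ∀ {ks} → First g ks → 2 ∈ ks →
    (∃ λ ls → CompositionWith2 (suc g) ls × ks ≡ 1 ∷ ls) ⊎ (∃ λ ls → Composition g ls × ks ≡ 2 ∷ ls)
  decompose (first-1 c) (there 2∈) = inj₁ (_ , (c , 2∈) , refl)
  decompose (first-2 c) _ = inj₂ (_ , c , refl)

count-depth-2 : ∀ g → Count (KunzTuple g 2) (fib (suc g) ∸ 1)
count-depth-2 g with count-compositions-with-2 g
... | n , eq , C = subst (λ f → Count (KunzTuple g 2) (f ∸ 1)) eq (count-cong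
  (λ (((pos , ≤2) , total) , 2∈) → kunzTuple pos (small-coordinates-kunz pos ≤2) total (≤2 , 2∈))
  (λ t → ((positive t , proj₁ (top t)) , total t) , proj₂ (top t))
  C)

-- Depths too large for three coordinates, and the eleven counts

count-extremes : ∀ {g q n} → g + 2 ≤ 2 * q → 1 ≤ g → q ≢ g → Count (Pairs g q) n → NumGapsets g q n
count-extremes {g} {q} {n} h 1≤g q≢g C = numGapsets 1≤g (subst (Count (KunzTuple g q)) (+-identityʳ n)
  (count-tuples 1≤g (linear 2 (λ g q → g ⊕ con 2 ≦ 2 ⊛ q ⇒ 2 ⊛ g ⊕ con 4 ≦ 5 ⊛ q) refl
    g q h) q≢g C (no-triples h)))

theorem7p4 : (g : ℕ) → 1 ≤ g →
    NumGapsets g 1 1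
    × NumGapsets g 2 (fib (g + 1) ∸ 1)
    × (∀ q → 2 * g + 4 < 5 * q → 2 * q ≤ g ∸ 1 → 23 ≤ g →
    NumGapsets g q ((g + 2 * q) / 3 + 2))
    × (∀ k → g ≡ 2 * k → 8 ≤ g → NumGapsets g k ((2 * g) / 3 + 2))
    × (∀ k → g ≡ 2 * k + 1 → 5 ≤ g → NumGapsets g (k + 1) (g / 3 + 2))
    × (∀ q → g + 2 ≤ 2 * q → 3 * q ≤ 2 * g → NumGapsets g q 2)
    × (∀ k → g ≡ 3 * k + 1 → 4 ≤ g → NumGapsets g (2 * k + 1) 1)
    × (∀ k → g ≡ 3 * k + 2 → 5 ≤ g → NumGapsets g (2 * k + 2) 0)
    × (∀ q → ceilDiv (2 * g) 3 + 1 ≤ q → q ≤ g ∸ 1 → NumGapsets g q 0)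
    × NumGapsets g g 1
    × (∀ q → g < q → NumGapsets g q 0)
theorem7p4 g 1≤g = part1 , part2 , part3 , part4 , part5 , part6 , part7 , part8 , part9 , part10 g 1≤g , part11
  where
  part1 = numGapsets 1≤g (count-depth-1 1≤g)
  part2 = numGapsets 1≤g (subst (λ n → Count (KunzTuple g 2) (fib n ∸ 1)) (+-comm 1 g) (count-depth-2 g))
  g∸1 : g ∸ 1 + 1 ≡ g
  g∸1 = m∸n+n≡m 1≤g

  part3 : ∀ q → 2 * g + 4 < 5 * q → 2 * q ≤ g ∸ 1 → 23 ≤ g → NumGapsets g q ((g + 2 * q) / 3 + 2)
  part3 q h 2q<g _ = numGapsets 1≤g (subst (λ g → Count (KunzTuple g q) ((g + 2 * q) / 3 + 2)) g≡
    (count-below-half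
      (linear 4 (λ g q s p → 2 ⊛ q ≦ p ⇒ p ⊕ con 1 ≐ g ⇒ q ⊕ s ≐ g ⇒ q ≺ s) refl
        g q (g ∸ q) (g ∸ 1) 2q<g g∸1 g≡)
      (linear 3 (λ g q s → 2 ⊛ g ⊕ con 4 ≺ 5 ⊛ q ⇒ q ⊕ s ≐ g ⇒ 2 ⊛ s ⊕ con 4 ≺ 3 ⊛ q) refl g q (g ∸ q) h g≡)))
    where
    g≡ : q + (g ∸ q) ≡ g
    g≡ = m+[n∸m]≡n (linear 3 (λ g q p → 2 ⊛ q ≦ p ⇒ p ⊕ con 1 ≐ g ⇒ q ≦ g) refl g q (g ∸ 1) 2q<g g∸1)

  part4 : ∀ k → g ≡ 2 * k → 8 ≤ g → NumGapsets g k ((2 * g) / 3 + 2)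
  part4 k refl 8≤g = numGapsets 1≤g (count-at-half (linear 1 (λ k → con 8 ≦ 2 ⊛ k ⇒ con 4 ≦ k) refl k 8≤g))

  part5 : ∀ k → g ≡ 2 * k + 1 → 5 ≤ g → NumGapsets g (k + 1) (g / 3 + 2)
  part5 k g≡ 5≤g = numGapsets 1≤g (subst (λ g → Count (KunzTuple g (k + 1)) (g / 3 + 2))
    (linear 2 (λ g k → g ≐ 2 ⊛ k ⊕ con 1 ⇒ k ⊕ con 1 ⊕ k ≐ g) refl g k g≡)
    (count-above-half (linear 2 (λ g k → g ≐ 2 ⊛ k ⊕ con 1 ⇒ con 5 ≦ g ⇒ con 2 ≦ k) refl g k g≡ 5≤g)))

  part6 : ∀ q → g + 2 ≤ 2 * q → 3 * q ≤ 2 * g → NumGapsets g q 2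
  part6 q h h′ = count-extremes h 1≤g
    (<⇒≢ (linear 2 (λ g q → con 1 ≦ g ⇒ 3 ⊛ q ≦ 2 ⊛ g ⇒ q ≺ g) refl g q 1≤g h′))
    (two-pairs (linear 2 (λ g q → g ⊕ con 2 ≦ 2 ⊛ q ⇒ g ≺ 2 ⊛ q) refl g q h) h′)

  part7 : ∀ k → g ≡ 3 * k + 1 → 4 ≤ g → NumGapsets g (2 * k + 1) 1
  part7 k g≡ 4≤g = count-extremes
    (linear 2 (λ g k → g ≐ 3 ⊛ k ⊕ con 1 ⇒ con 4 ≦ g ⇒ g ⊕ con 2 ≦ 2 ⊛ (2 ⊛ k ⊕ con 1)) refl g k g≡ 4≤g)
    1≤g (<⇒≢ q<g)
    (one-pair-extremal 1≤g q<g (linear 2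
      (λ g k → g ≐ 3 ⊛ k ⊕ con 1 ⇒ 3 ⊛ (2 ⊛ k ⊕ con 1) ≐ 2 ⊛ g ⊕ con 1) refl
      g k g≡))
    where q<g = linear 2 (λ g k → g ≐ 3 ⊛ k ⊕ con 1 ⇒ con 4 ≦ g ⇒ 2 ⊛ k ⊕ con 1 ≺ g) refl g k g≡ 4≤g

  part8 : ∀ k → g ≡ 3 * k + 2 → 5 ≤ g → NumGapsets g (2 * k + 2) 0
  part8 k g≡ 5≤g = count-extremes
    (linear 2 (λ g k → g ≐ 3 ⊛ k ⊕ con 2 ⇒ con 5 ≦ g ⇒ g ⊕ con 2 ≦ 2 ⊛ (2 ⊛ k ⊕ con 2)) refl g k g≡ 5≤g)
    1≤g
    (<⇒≢ (linear 2 (λ g k → g ≐ 3 ⊛ k ⊕ con 2 ⇒ con 5 ≦ g ⇒ 2 ⊛ k ⊕ con 2 ≺ g) refl g k g≡ 5≤g))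
    (no-pairs (inj₂ (linear 2 (λ g k → g ≐ 3 ⊛ k ⊕ con 2 ⇒ 2 ⊛ g ⊕ con 2 ≦ 3 ⊛ (2 ⊛ k ⊕ con 2)) refl g k g≡)))

  part9 : ∀ q → ceilDiv (2 * g) 3 + 1 ≤ q → q ≤ g ∸ 1 → NumGapsets g q 0
  part9 q h h′ = count-extremes
    (linear 2 (λ g q → 2 ⊛ g ⊕ con 3 ≦ 3 ⊛ q ⇒ g ⊕ con 2 ≦ 2 ⊛ q) refl g q 3q)
    1≤g
    (<⇒≢ (linear 3 (λ g q p → q ≦ p ⇒ p ⊕ con 1 ≐ g ⇒ q ≺ g) refl g q (g ∸ 1) h′ g∸1))
    (no-pairs (inj₂ (linear 2 (λ g q → 2 ⊛ g ⊕ con 3 ≦ 3 ⊛ q ⇒ 2 ⊛ g ⊕ con 2 ≦ 3 ⊛ q) refl g q 3q)))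
    where
    -- This is the numerator to which `ceilDiv (2 * g) 3` unfolds, so its quotient by 3 is the
    -- ceiling in the hypothesis.
    x = 2 * g + 2
    3q : 2 * g + 3 ≤ 3 * q
    3q = linear 4 (λ g q r d → 2 ⊛ g ⊕ con 2 ≐ r ⊕ 3 ⊛ d ⇒ r ≺ con 3 ⇒ d ⊕ con 1 ≦ q ⇒ 2 ⊛ g ⊕ con 3 ≦ 3 ⊛ q) refl
      g q (x % 3) (x / 3) (division-by-3 x) (m%n<n x 3) h

  part10 : ∀ g → 1 ≤ g → NumGapsets g g 1
  -- At g = q = 1 the bound 2g + 4 ≤ 5q fails, but there depth g is depth 1.
  part10 1 1≤g = numGapsets 1≤g (count-depth-1 1≤g)
  part10 (suc (suc g)) 1≤g = numGapsets 1≤g (count-hyperelliptic (s≤s (s≤s z≤n)))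

  part11 : ∀ q → g < q → NumGapsets g q 0
  part11 q g<q = count-extremes
    (linear 2 (λ g q → con 1 ≦ g ⇒ g ≺ q ⇒ g ⊕ con 2 ≦ 2 ⊛ q) refl g q 1≤g g<q)
    1≤g (<⇒≢ g<q ∘ sym)
    (no-pairs (inj₂ (linear 2 (λ g q → g ≺ q ⇒ 2 ⊛ g ⊕ con 2 ≦ 3 ⊛ q) refl g q g<q)))
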